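{- The complete bipartite graph $K_{2,2}$ is not isomorphic to the rook equivalence graph $G(B)$ of any Ferrers board $B$.
   Context: A Ferrers board is given by a weakly increasing sequence of non-negative integers $B=(b_1,\ldots,b_n)$ of column heights; it is the set of unit cells in the first quadrant lying in column $i$ and rows $1,\ldots,b_i$. Prepending columns of height $0$ on the left does not change the board, and boards are compared using the same number of columns by such padding. A placement of $k$ rooks on $B$ is a set of $k$ cells of $B$ no two in the same row or column; $r_k(B)$ is the number of such placements. Two boards are rook equivalent if they have equal $r_k$ for all $k\ge 0$. The rook equivalence graph $G(B)$ has as vertices all Ferrers boards rook equivalent to $B$, and $\{B_1,B_2\}$ is an edge iff, written with the same number of columns, $B_1$ and $B_2$ differ in exactly two columns $i$ and $j$, where $B_1$ has $k$ more cells than $B_2$ in column $i$ and $k$ fewer cells than $B_2$ in column $j$, for some $k>0$. -}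

module Defs where

open import Data.Empty using (⊥)
open import Data.Fin using (Fin; zero; suc)
open import Data.List as List using (List; []; _∷_; _++_; length; filter; replicate)
open import Data.List.Properties using (length-++; length-replicate)
open import Data.List.Relation.Unary.AllPairs using (allPairs?)
open import Data.Nat using (ℕ; zero; suc; _+_; _<_)
open import Data.Nat.Properties
  using (≤-totalOrder; _≟_; +-comm; +-cancelʳ-≡; +-cancelˡ-≡; <⇒≢)
open import Data.List.Relation.Unary.Sorted.TotalOrder ≤-totalOrder using (Sorted)
open import Data.Product using (Σ-syntax; ∃-syntax; _×_; _,_; proj₁; proj₂)
open import Data.Sum using (_⊎_; inj₁; inj₂)
open import Data.Unit using (⊤; tt)
open import Data.Vec as Vec using (Vec; lookup; toList)
open import Data.Vec.Properties using (length-toList; toList-injective; cast-is-id)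
open import Function.Base using (_on_)
open import Function.Bundles using (Bijection; _⇔_)
open import Level using (0ℓ)
open import Relation.Binary using (Rel; Setoid; IsEquivalence; Decidable; Symmetric; _Respects₂_)
import Relation.Binary.Construct.On as On
open import Relation.Binary.PropositionalEquality
  using (_≡_; _≢_; refl; sym; ≢-sym; trans; cong; subst; setoid; module ≡-Reasoning)
open import Relation.Nullary using (¬_; ¬?)
open import Relation.Nullary.Decidable using (_×-dec_)

record Graph : Set₁ where
  field
    vertices : Setoid 0ℓ 0ℓ
  open Setoid vertices public using () renaming (Carrier to Vertex; _≈_ to _≈ᵛ_)
  field
    Adj      : Rel Vertex 0ℓ
    respects : Adj Respects₂ _≈ᵛ_
    symm     : Symmetric Adj
    irrefl   : ∀ {x} → ¬ Adj x x

record _≅_ (G H : Graph) : Set where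
  private
    module G = Graph G
    module H = Graph H
  field
    bijection : Bijection G.vertices H.vertices
  open Bijection bijection public using (to)
  field
    adj⇔adj : ∀ x y → G.Adj x y ⇔ H.Adj (to x) (to y)

infix 4 _≅_

OnOppositeSides : ∀ {m n} → Rel (Fin m ⊎ Fin n) 0ℓ
OnOppositeSides (inj₁ _) (inj₁ _) = ⊥
OnOppositeSides (inj₁ _) (inj₂ _) = ⊤
OnOppositeSides (inj₂ _) (inj₁ _) = ⊤
OnOppositeSides (inj₂ _) (inj₂ _) = ⊥

K : ℕ → ℕ → Graph
K m n = record
  { vertices = setoid (Fin m ⊎ Fin n)
  ; Adj      = OnOppositeSides
  ; respects = (λ { refl a → a }) , (λ { refl a → a })
  ; symm     = λ {x} {y} → symm x y
  ; irrefl   = λ {x} → irrefl x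
  }
  where
  symm : (x y : Fin m ⊎ Fin n) → OnOppositeSides x y → OnOppositeSides y x
  symm (inj₁ _) (inj₂ _) _ = tt
  symm (inj₂ _) (inj₁ _) _ = tt

  irrefl : (x : Fin m ⊎ Fin n) → ¬ OnOppositeSides x x
  irrefl (inj₁ _) ()
  irrefl (inj₂ _) ()

record Board : Set where
  constructor board
  field
    columns : List ℕ
    sorted  : Sorted columns

open Board public

pad : ℕ → List ℕ → List ℕ
pad p bs = replicate p 0 ++ bs

infix 4 _≈_

-- Equality of boards up to columns of height 0 on the left.
_≈_ : Rel Board 0ℓ
A ≈ B = ∃[ p ] ∃[ q ] pad p (columns A) ≡ pad q (columns B)

pad-+ : ∀ p q bs → pad (p + q) bs ≡ pad p (pad q bs)
pad-+ zero    q bs = refl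
pad-+ (suc p) q bs = cong (0 ∷_) (pad-+ p q bs)

pad-comm : ∀ p q bs → pad p (pad q bs) ≡ pad q (pad p bs)
pad-comm p q bs = begin
  pad p (pad q bs)  ≡⟨ pad-+ p q bs ⟨
  pad (p + q) bs    ≡⟨ cong (λ s → pad s bs) (+-comm p q) ⟩
  pad (q + p) bs    ≡⟨ pad-+ q p bs ⟩
  pad q (pad p bs)  ∎
  where open ≡-Reasoning

≈-isEquivalence : IsEquivalence _≈_
≈-isEquivalence = record
  { refl  = 0 , 0 , refl
  ; sym   = λ { (p , q , eq) → q , p , sym eq }
  ; trans = λ {A} {B} {C} → λ { (p , q , eq) (r , s , eq′) →
      r + p , q + s , (begin
        pad (r + p) (columns A)    ≡⟨ pad-+ r p _ ⟩
        pad r (pad p (columns A))  ≡⟨ cong (pad r) eq ⟩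
        pad r (pad q (columns B))  ≡⟨ pad-comm r q _ ⟩
        pad q (pad r (columns B))  ≡⟨ cong (pad q) eq′ ⟩
        pad q (pad s (columns C))  ≡⟨ pad-+ q s _ ⟨
        pad (q + s) (columns C)    ∎) }
  }
  where open ≡-Reasoning

boardSetoid : Setoid 0ℓ 0ℓ
boardSetoid = record { isEquivalence = ≈-isEquivalence }

-- A cell is a pair (column , row), both numbered from 1.
Cell : Set
Cell = ℕ × ℕ

cellsFrom : ℕ → List ℕ → List Cell
cellsFrom i []       = []
cellsFrom i (b ∷ bs) = List.applyUpTo (λ j → i , suc j) b ++ cellsFrom (suc i) bs

cells : Board → List Cell
cells B = cellsFrom 1 (columns B)

-- The k-element subsets of the set listed, without repetition, by xs.
subsets : ∀ {A : Set} → ℕ → List A → List (List A)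
subsets zero    _        = [] ∷ []
subsets (suc k) []       = []
subsets (suc k) (x ∷ xs) = List.map (x ∷_) (subsets k xs) ++ subsets (suc k) xs

NonAttacking : Rel Cell 0ℓ
NonAttacking c d = proj₁ c ≢ proj₁ d × proj₂ c ≢ proj₂ d

nonAttacking? : Decidable NonAttacking
nonAttacking? c d = ¬? (proj₁ c ≟ proj₁ d) ×-dec ¬? (proj₂ c ≟ proj₂ d)

placements : ℕ → Board → List (List Cell)
placements k B = filter (allPairs? nonAttacking?) (subsets k (cells B))

rookNumber : ℕ → Board → ℕ
rookNumber k B = length (placements k B)

RookEquivalent : Rel Board 0ℓ
RookEquivalent A B = ∀ k → rookNumber k A ≡ rookNumber k B

-- The board, padded to n columns, is written as u.
_WrittenAs_ : Board → ∀ {n} → Vec ℕ n → Set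
B WrittenAs u = ∃[ p ] toList u ≡ pad p (columns B)

Exchange : ∀ {n} → Rel (Vec ℕ n) 0ℓ
Exchange {n} u v =
  Σ[ i ∈ Fin n ] Σ[ j ∈ Fin n ] Σ[ k ∈ ℕ ]
    i ≢ j
  × 0 < k
  × lookup u i ≡ lookup v i + k
  × lookup u j + k ≡ lookup v j
  × (∀ l → l ≢ i → l ≢ j → lookup u l ≡ lookup v l)

Adjacent : Rel Board 0ℓ
Adjacent A B =
  ∃[ n ] Σ[ u ∈ Vec ℕ n ] Σ[ v ∈ Vec ℕ n ]
    A WrittenAs u × B WrittenAs v × Exchange u v

exchange-sym : ∀ {n} → Symmetric (Exchange {n})
exchange-sym (i , j , k , i≢j , 0<k , ui , uj , rest) =
  j , i , k , ≢-sym i≢j , 0<k , sym uj , sym ui , λ l l≢j l≢i → sym (rest l l≢i l≢j)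

exchange-irrefl : ∀ {n} {u : Vec ℕ n} → ¬ Exchange u u
exchange-irrefl {u = u} (i , j , k , i≢j , 0<k , ui , uj , rest) =
  <⇒≢ 0<k (sym (+-cancelˡ-≡ (lookup u j) k 0 (trans uj (+-comm 0 (lookup u j)))))

padVec : ∀ p {n} → Vec ℕ n → Vec ℕ (p + n)
padVec zero    u = u
padVec (suc p) u = 0 Vec.∷ padVec p u

toList-padVec : ∀ p {n} (u : Vec ℕ n) → toList (padVec p u) ≡ pad p (toList u)
toList-padVec zero    u = refl
toList-padVec (suc p) u = cong (0 ∷_) (toList-padVec p u)

exchange-0∷ : ∀ {n} {u v : Vec ℕ n} → Exchange u v → Exchange (0 Vec.∷ u) (0 Vec.∷ v)
exchange-0∷ (i , j , k , i≢j , 0<k , ui , uj , rest) =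
  suc i , suc j , k , (λ { refl → i≢j refl }) , 0<k , ui , uj , λ
    { zero    _   _   → refl
    ; (suc l) l≢i l≢j → rest l (λ { refl → l≢i refl }) (λ { refl → l≢j refl })
    }

exchange-padVec : ∀ p {n} {u v : Vec ℕ n} → Exchange u v → Exchange (padVec p u) (padVec p v)
exchange-padVec zero    e = e
exchange-padVec (suc p) e = exchange-0∷ (exchange-padVec p e)

writtenAs-≈ : ∀ {A B n} {u : Vec ℕ n} → ((p , _) : A ≈ B) →
              A WrittenAs u → B WrittenAs padVec p u
writtenAs-≈ {A} {B} {u = u} (p , q , eq) (a , ua) = a + q , (begin
  toList (padVec p u)        ≡⟨ toList-padVec p u ⟩
  pad p (toList u)           ≡⟨ cong (pad p) ua ⟩
  pad p (pad a (columns A))  ≡⟨ pad-comm p a _ ⟩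
  pad a (pad p (columns A))  ≡⟨ cong (pad a) eq ⟩
  pad a (pad q (columns B))  ≡⟨ pad-+ a q _ ⟨
  pad (a + q) (columns B)    ∎)
  where open ≡-Reasoning

writtenAs-padVec : ∀ p {B n} {u : Vec ℕ n} → B WrittenAs u → B WrittenAs padVec p u
writtenAs-padVec p {B} {u = u} (b , ub) =
  p + b , trans (toList-padVec p u) (trans (cong (pad p) ub) (sym (pad-+ p b (columns B))))

writtenAs-unique : ∀ {A n} {u v : Vec ℕ n} → A WrittenAs u → A WrittenAs v → u ≡ v
writtenAs-unique {A} {n} {u} {v} (a , ua) (b , vb) =
  trans (sym (cast-is-id refl u)) (toList-injective refl u v
    (trans ua (trans (cong (λ p → pad p (columns A)) a≡b) (sym vb))))
  where
  width : ∀ p {w : Vec ℕ n} → toList w ≡ pad p (columns A) → p + length (columns A) ≡ n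
  width p {w} eq = begin
    p + length (columns A)                       ≡⟨ cong (_+ length (columns A)) (length-replicate p) ⟨
    length (replicate p 0) + length (columns A)  ≡⟨ length-++ (replicate p 0) ⟨
    length (pad p (columns A))                   ≡⟨ cong length eq ⟨
    length (toList w)                            ≡⟨ length-toList w ⟩
    n                                            ∎
    where open ≡-Reasoning
  a≡b : a ≡ b
  a≡b = +-cancelʳ-≡ (length (columns A)) a b (trans (width a ua) (sym (width b vb)))

adjacent-sym : Symmetric Adjacent
adjacent-sym (n , u , v , Au , Bv , e) = n , v , u , Bv , Au , exchange-sym {x = u} {y = v} e

adjacent-respʳ : ∀ {A B C} → B ≈ C → Adjacent A B → Adjacent A C
adjacent-respʳ {A} {B} {C} B≈C@(p , _) (n , u , v , Au , Bv , e) =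
  p + n , padVec p u , padVec p v ,
  writtenAs-padVec p {A} Au , writtenAs-≈ {B} {C} B≈C Bv , exchange-padVec p e

adjacent-respˡ : ∀ {A B C} → A ≈ B → Adjacent A C → Adjacent B C
adjacent-respˡ {A} {B} {C} A≈B e =
  adjacent-sym {C} {B} (adjacent-respʳ {C} {A} {B} A≈B (adjacent-sym {A} {C} e))

adjacent-irrefl : ∀ {A} → ¬ Adjacent A A
adjacent-irrefl {A} (n , u , v , Au , Av , e) =
  exchange-irrefl {u = u} (subst (Exchange u) (sym (writtenAs-unique {A} Au Av)) e)

rookEquivalenceGraph : Board → Graph
rookEquivalenceGraph B = record
  { vertices = On.setoid boardSetoid (proj₁ {B = RookEquivalent B})
  ; Adj      = Adjacent on proj₁
  ; respects = (λ {x} {y} {z} → adjacent-respʳ {proj₁ x} {proj₁ y} {proj₁ z})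
             , (λ {x} {y} {z} → adjacent-respˡ {proj₁ y} {proj₁ z} {proj₁ x})
  ; symm     = λ {x} {y} → adjacent-sym {proj₁ x} {proj₁ y}
  ; irrefl   = λ {x} → adjacent-irrefl {proj₁ x}
  }

{-# OPTIONS --safe #-}
module Submission where

-- Pad all boards to a common large width and write a board as the word of the
-- letters i − b, with i the number of columns to the left of a column of height
-- b.  Ferrers boards become the preorder depth sequences of plane trees.  As in
-- the factorisation theorem of Goldman, Joichi and White, the rook numbers of a
-- board depend only on the multiset of its letters, and equality of the second
-- rook numbers turns an edge of the graph into an interchange of two letters.
-- So the graph consists of all depth sequences with given letters, two of them
-- adjacent iff their Hamming distance is 2, and K₂,₂ has to be excluded there.
--
-- A letter a that occurs once at the start is common to all words and can be
-- dropped.  Otherwise let v be the rest of the word after deleting all a.  If v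
-- is constant, there are triangles or too few words.  If not, a v a … and a a v …
-- are not adjacent.  With three or more a, this gives a vertex with two
-- non-neighbours.  With two, a v a and a a v form one side of K₂,₂, and for a
-- vertex a x a y of the other side, w = x y differs from v and a w a, a a w form
-- that side; these adjacencies force v and w to be rotations of each other by
-- one letter in both directions, hence constant.

open import Defs
open import Data.Bool using (Bool; true; false; not; if_then_else_)
open import Data.Bool.Properties using (not-involutive)
open import Data.Empty using (⊥)
open import Data.Fin using (Fin; zero; suc)
open import Data.Integer as ℤ using (ℤ; +_; 0ℤ; 1ℤ)
import Data.Integer.Properties as ℤ
open import Data.Integer.Tactic.RingSolver using (solve-∀)
open import Data.List as List
  using (List; []; _∷_; _++_; [_]; length; replicate; filter; map; upTo; initLast; _∷ʳ′_)
open import Data.List.Membership.Propositional using (_∈_; _∉_)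
open import Data.List.Membership.Propositional.Properties using (∈-∃++; ∈-upTo⁺; ∈-upTo⁻)
open import Data.List.Properties
  using (∷-injective; ∷-injectiveˡ; ∷-injectiveʳ; ++-assoc; ++-cancelˡ; ++-identityʳ; ∷ʳ-injectiveˡ; ∷ʳ-++;
         length-++; length-replicate; length-upTo; map-upTo;
         filter-++; filter-≐; filter-accept; filter-reject; filter-none; filter-all)
open import Data.List.Relation.Binary.Permutation.Propositional as Perm
  using (_↭_; ↭-sym; ↭-trans; ↭-refl; ↭-reflexive; prep; swap)
open import Data.List.Relation.Binary.Permutation.Propositional.Properties
  using (All-resp-↭; ∈-resp-↭; ↭-length; ↭-singleton-inv; shift; drop-∷; drop-mid; ++-comm; ++⁺ˡ)
open import Data.List.Relation.Unary.All as All using (All; []; _∷_; all?)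
import Data.List.Relation.Unary.All.Properties as All
open import Data.List.Relation.Unary.AllPairs using (AllPairs; []; _∷_; allPairs?)
open import Data.List.Relation.Unary.Any using (here; there)
open import Data.List.Relation.Unary.Linked as Linked using (Linked; []; [-]; _∷_)
open import Data.List.Relation.Unary.Unique.Propositional using (Unique)
open import Data.List.Relation.Unary.Unique.Propositional.Properties using (upTo⁺)
open import Data.Nat
open import Data.Nat.ListAction using (sum)
open import Data.Nat.ListAction.Properties using (sum-↭)
open import Data.Nat.Properties
open import Data.List.Membership.DecPropositional _≟_ using (_∈?_)
open import Data.Product using (Σ-syntax; ∃-syntax; _×_; _,_; proj₁; proj₂)
open import Data.Sum using (_⊎_; inj₁; inj₂)
open import Data.Unit using (tt)
open import Data.Vec as Vec using (Vec; lookup; toList)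
open import Data.Vec.Properties using (tabulate∘lookup; tabulate-cong; length-toList; toList∘fromList)
open import Function using (_∘_)
open import Function.Bundles using (Bijection; Equivalence)
open import Level using (0ℓ)
open import Relation.Binary.Definitions using (tri<; tri≈; tri>)
open import Relation.Binary.PropositionalEquality
  using (_≡_; _≢_; ≢-sym; refl; sym; trans; cong; cong₂; subst₂; module ≡-Reasoning)
open import Relation.Nullary using (¬_; does; yes; no; contradiction)
open import Relation.Nullary.Decidable using (_×-dec_; dec-true; dec-false)
open import Relation.Unary using (Pred; Decidable)

-- Rook numbers by columns

length-filter-map : ∀ {A B : Set} {P : Pred B 0ℓ} (P? : Decidable P) (f : A → B) xs →
                    length (filter P? (map f xs)) ≡ length (filter (P? ∘ f) xs)
length-filter-map P? f []       = refl
length-filter-map P? f (x ∷ xs) with P? (f x)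
... | yes _ = cong suc (length-filter-map P? f xs)
... | no  _ = length-filter-map P? f xs

Safe : List Cell → Cell → Set
Safe P c = All (NonAttacking c) P

safe? : ∀ P → Decidable (Safe P)
safe? P c = all? (nonAttacking? c) P

-- `P` holds the rooks already placed; as an accumulator it lets placements be counted column by
-- column.
Extends : List Cell → List Cell → Set
Extends P S = All (Safe P) S × AllPairs NonAttacking S

extends? : ∀ P → Decidable (Extends P)
extends? P S = all? (safe? P) S ×-dec allPairs? nonAttacking? S

extensions : List Cell → ℕ → List Cell → ℕ
extensions P k xs = length (filter (extends? P) (subsets k xs))

nonAttacking-sym : ∀ {c d} → NonAttacking c d → NonAttacking d c
nonAttacking-sym (p , q) = ≢-sym p , ≢-sym q

extensions-split : ∀ P k x xs → extensions P (suc k) (x ∷ xs) ≡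
                   length (filter (extends? P ∘ (x ∷_)) (subsets k xs)) + extensions P (suc k) xs
extensions-split P k x xs
  rewrite filter-++ (extends? P) (map (x ∷_) (subsets k xs)) (subsets (suc k) xs)
        | length-++ (filter (extends? P) (map (x ∷_) (subsets k xs))) {filter (extends? P) (subsets (suc k) xs)}
  = cong (_+ _) (length-filter-map (extends? P) (x ∷_) (subsets k xs))

-- Either a rook stands on `x` and joins `P`, or `x` stays empty.
extensions-safe : ∀ P k x xs → Safe P x →
                  extensions P (suc k) (x ∷ xs) ≡ extensions (x ∷ P) k xs + extensions P (suc k) xs
extensions-safe P k x xs safe = trans (extensions-split P k x xs) (cong (λ ys → length ys + _)
  (filter-≐ (extends? P ∘ (x ∷_)) (extends? (x ∷ P)) (to , from) (subsets k xs)))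
  where
  to : ∀ {S} → Extends P (x ∷ S) → Extends (x ∷ P) S
  to (_ ∷ s , n ∷ p) = All.zipWith (λ (c , d) → nonAttacking-sym c ∷ d) (n , s) , p
  from : ∀ {S} → Extends (x ∷ P) S → Extends P (x ∷ S)
  from (s , p) = safe ∷ All.map All.tail s , All.map (nonAttacking-sym ∘ All.head) s ∷ p

extensions-attacked : ∀ P k x xs → ¬ Safe P x → extensions P k (x ∷ xs) ≡ extensions P k xs
extensions-attacked P zero    x xs _       = refl
extensions-attacked P (suc k) x xs ¬safe = trans (extensions-split P k x xs) (cong (λ ys → length ys + _)
  (filter-none (extends? P ∘ (x ∷_)) (All.universal (λ S (s , _) → ¬safe (All.head s)) (subsets k xs))))

extensions-++-attacked : ∀ P k ys xs → All (¬_ ∘ Safe P) ys → extensions P k (ys ++ xs) ≡ extensions P k xs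
extensions-++-attacked P k []       xs []        = refl
extensions-++-attacked P k (y ∷ ys) xs (a ∷ as) =
  trans (extensions-attacked P k y (ys ++ xs) a) (extensions-++-attacked P k ys xs as)

rookNumber≡extensions : ∀ k B → rookNumber k B ≡ extensions [] k (cells B)
rookNumber≡extensions k B = cong length (filter-≐ (allPairs? nonAttacking?) (extends? [])
  ((λ p → All.universal (λ _ → []) _ , p) , proj₂) (subsets k (cells B)))

column : ℕ → List ℕ → List Cell
column c = map (λ r → c , suc r)

safe-rows : List Cell → ℕ → List ℕ → List ℕ
safe-rows P c = filter (λ r → safe? P (c , suc r))

-- At most one rook goes into column c.
extensions-column : ∀ P k c rs xs g →
  (∀ {r} → r ∈ rs → Safe P (c , suc r) → + extensions ((c , suc r) ∷ P) k xs ≡ g) →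
  + extensions P (suc k) (column c rs ++ xs) ≡
  + length (safe-rows P c rs) ℤ.* g ℤ.+ + extensions P (suc k) xs
extensions-column P k c []       xs g _ = sym (trans (cong (λ z → z ℤ.+ + extensions P (suc k) xs) (ℤ.*-zeroˡ g)) (ℤ.+-identityˡ _))
extensions-column P k c (r ∷ rs) xs g eq with safe? P (c , suc r)
... | no ¬safe = trans (cong +_ (extensions-attacked P (suc k) _ _ ¬safe))
                   (extensions-column P k c rs xs g (eq ∘ there))
... | yes safe = begin
  + extensions P (suc k) (column c (r ∷ rs) ++ xs)
    ≡⟨ cong +_ (extensions-safe P k _ _ safe) ⟩
  + extensions P′ k (column c rs ++ xs) ℤ.+ + extensions P (suc k) (column c rs ++ xs)
    -- A rook on this cell attacks the rest of column `c`, which therefore drops out.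
    ≡⟨ cong₂ ℤ._+_ (trans (cong +_ (extensions-++-attacked P′ k (column c rs) xs attacked)) (eq (here refl) safe))
                   (extensions-column P k c rs xs g (eq ∘ there)) ⟩
  g ℤ.+ (+ n ℤ.* g ℤ.+ e)
    ≡⟨ ring g (+ n) e ⟩
  + suc n ℤ.* g ℤ.+ e
    ∎
  where
  open ≡-Reasoning
  P′ = (c , suc r) ∷ P
  n = length (safe-rows P c rs)
  e = + extensions P (suc k) xs
  attacked : All (¬_ ∘ Safe P′) (column c rs)
  attacked = All.map⁺ (All.universal (λ _ s → proj₁ (All.head s) refl) rs)
  ring : ∀ g n e → g ℤ.+ (n ℤ.* g ℤ.+ e) ≡ (1ℤ ℤ.+ n) ℤ.* g ℤ.+ e
  ring = solve-∀

filter-remove : ∀ {P Q : Pred ℕ 0ℓ} (P? : Decidable P) (Q? : Decidable Q) {y} →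
                (∀ {x} → P x → x ≢ y × Q x) → (∀ {x} → x ≢ y → Q x → P x) →
                ∀ {xs} → Unique xs → y ∈ xs → Q y → suc (length (filter P? xs)) ≡ length (filter Q? xs)
filter-remove {P} {Q} P? Q? {y} to from = remove
  where
  keep : ∀ {xs} → All (y ≢_) xs → filter P? xs ≡ filter Q? xs
  keep []                  = refl
  keep (_∷_ {x = x} y≢x p) with Q? x
  ... | yes q = trans (filter-accept P? (from (≢-sym y≢x) q)) (cong (x ∷_) (keep p))
  ... | no ¬q = trans (filter-reject P? (¬q ∘ proj₂ ∘ to)) (keep p)
  remove : ∀ {xs} → Unique xs → y ∈ xs → Q y → suc (length (filter P? xs)) ≡ length (filter Q? xs)
  remove (u ∷ _) (here refl) q = trans
    (cong (suc ∘ length) (trans (filter-reject P? (λ p → proj₁ (to p) refl)) (keep u)))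
    (sym (cong length (filter-accept Q? q)))
  remove {x ∷ xs} (u ∷ us) (there y∈) q with Q? x
  ... | yes q′ = cong suc (trans (cong length (filter-accept P? (from (All.lookup u y∈) q′))) (remove us y∈ q))
  ... | no ¬q  = trans (cong (suc ∘ length) (filter-reject P? (¬q ∘ proj₂ ∘ to))) (remove us y∈ q)

-- The rooks of P stand in the columns before c and in the rows 1, …, m.
Within : ℕ → ℕ → List Cell → Set
Within c m = All (λ p → proj₁ p < c × ∃[ r ] proj₂ p ≡ suc r × r < m)

Within-mono : ∀ {c m n P} → m ≤ n → Within c m P → Within (suc c) n P
Within-mono m≤n = All.map λ (c , r , eq , r<m) → m≤n⇒m≤1+n c , r , eq , ≤-trans r<m m≤n

Within-wider : ∀ {c m n P} → m ≤ n → Within c m P → Within c n P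
Within-wider m≤n = All.map λ (c , r , eq , r<m) → c , r , eq , ≤-trans r<m m≤n

-- The rooks of `P` stand in distinct rows among 1, ..., `b`, so each blocks exactly one cell of the
-- column; `filter-remove` takes them into account one at a time.
length-safe-rows : ∀ {c b P} → Within c b P → AllPairs NonAttacking P →
                   length (safe-rows P c (upTo b)) + length P ≡ b
length-safe-rows {c} {b} [] [] = trans (+-identityʳ _)
  (trans (cong length (filter-all (λ r → safe? [] (c , suc r)) (All.universal (λ _ → []) (upTo b)))) (length-upTo b))
length-safe-rows {c} {b} {p ∷ P} ((c′<c , r , refl , r<b) ∷ w) (n ∷ a) = trans (+-suc _ _) (trans
  (cong (_+ length P) (filter-remove (λ x → safe? (p ∷ P) (c , suc x)) (λ x → safe? P (c , suc x)) {y = r}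
    (λ { ((_ , x≢r) ∷ s) → (x≢r ∘ cong suc) , s })
    (λ x≢r s → (≢-sym (<⇒≢ c′<c) , x≢r ∘ suc-injective) ∷ s)
    (upTo⁺ b) (∈-upTo⁺ r<b)
    -- The row of `p` is not blocked by the other rooks, since `p` does not attack them.
    (All.zipWith (λ ((c″<c , _) , (_ , r≢)) → ≢-sym (<⇒≢ c″<c) , r≢) (w , n))))
  (length-safe-rows w a))

-- The number of ways to add k rooks in the columns bs of a Ferrers board when j
-- rooks already stand in the columns to their left.
rooks : ℕ → ℕ → List ℕ → ℤ
rooks j zero    _        = 1ℤ
rooks j (suc k) []       = 0ℤ
rooks j (suc k) (b ∷ bs) = rooks j (suc k) bs ℤ.+ (+ b ℤ.- + j) ℤ.* rooks (suc j) k bs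

-- The columns being sorted, every rook of P blocks a cell of each further column.
extensions≡rooks : ∀ {c m bs P} k → Linked _≤_ (m ∷ bs) → Within c m P → AllPairs NonAttacking P →
                   + extensions P k (cellsFrom c bs) ≡ rooks (length P) k bs
extensions≡rooks zero _ _ _ = refl
extensions≡rooks {bs = []} (suc k) _ _ _ = refl
extensions≡rooks {c} {m} {b ∷ bs} {P} (suc k) (m≤b ∷ l) w a = begin
  + extensions P (suc k) (List.applyUpTo (λ r → c , suc r) b ++ xs)
    ≡⟨ cong (λ ys → + extensions P (suc k) (ys ++ xs)) (map-upTo (λ r → c , suc r) b) ⟨
  + extensions P (suc k) (column c (upTo b) ++ xs)
    ≡⟨ extensions-column P k c (upTo b) xs (rooks (suc (length P)) k bs) placed ⟩
  + n ℤ.* rooks (suc (length P)) k bs ℤ.+ + extensions P (suc k) xs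
    ≡⟨ cong₂ (λ d e → d ℤ.* rooks (suc (length P)) k bs ℤ.+ e) n≡ (extensions≡rooks (suc k) l (Within-mono m≤b w) a) ⟩
  (+ b ℤ.- + length P) ℤ.* rooks (suc (length P)) k bs ℤ.+ rooks (length P) (suc k) bs
    ≡⟨ ℤ.+-comm _ (rooks (length P) (suc k) bs) ⟩
  rooks (length P) (suc k) (b ∷ bs)
    ∎
  where
  open ≡-Reasoning
  xs = cellsFrom (suc c) bs
  n = length (safe-rows P c (upTo b))
  ring : ∀ n p → n ≡ n ℤ.+ p ℤ.- p
  ring = solve-∀
  n≡ : + n ≡ + b ℤ.- + length P
  n≡ = trans (ring (+ n) (+ length P)) (cong (λ s → + s ℤ.- + length P) (length-safe-rows (Within-wider m≤b w) a))
  placed : ∀ {r} → r ∈ upTo b → Safe P (c , suc r) →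
           + extensions ((c , suc r) ∷ P) k xs ≡ rooks (suc (length P)) k bs
  placed {r} r∈ s = extensions≡rooks k l ((≤-refl , r , refl , ∈-upTo⁻ r∈) ∷ Within-mono m≤b w) (s ∷ a)

0∷-sorted : ∀ {bs} → Linked _≤_ bs → Linked _≤_ (0 ∷ bs)
0∷-sorted []      = [-]
0∷-sorted [-]     = z≤n ∷ [-]
0∷-sorted (p ∷ l) = z≤n ∷ p ∷ l

rookNumber≡rooks : ∀ k B → + rookNumber k B ≡ rooks 0 k (columns B)
rookNumber≡rooks k B = trans (cong +_ (rookNumber≡extensions k B))
  (extensions≡rooks k (0∷-sorted (sorted B)) [] [])

rooks-0∷ : ∀ k bs → rooks 0 k (0 ∷ bs) ≡ rooks 0 k bs
rooks-0∷ zero    bs = refl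
rooks-0∷ (suc k) bs = trans (cong (λ z → rooks 0 (suc k) bs ℤ.+ z) (ℤ.*-zeroˡ (rooks 1 k bs))) (ℤ.+-identityʳ _)

rooks-pad : ∀ p k bs → rooks 0 k (pad p bs) ≡ rooks 0 k bs
rooks-pad zero    k bs = refl
rooks-pad (suc p) k bs = trans (rooks-0∷ k (pad p bs)) (rooks-pad p k bs)

-- The same numbers in terms of the letters x = i − b, where i is the number of
-- columns to the left of a column of height b.
rooksᵈ : ℕ → ℕ → ℕ → List ℕ → ℤ
rooksᵈ i j zero    _       = 1ℤ
rooksᵈ i j (suc k) []      = 0ℤ
rooksᵈ i j (suc k) (x ∷ w) = rooksᵈ (suc i) j (suc k) w ℤ.+ (+ i ℤ.- + x ℤ.- + j) ℤ.* rooksᵈ (suc i) (suc j) k w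

-- A rook in exactly one of two neighbouring columns contributes a sum of two factors that is
-- symmetric in `x` and `y`. With rooks in both, the extra column and the extra rook cancel in the
-- second factor, which leaves `(i − x − j)(i − y − j)`.
rooksᵈ-swap : ∀ i j k x y w → rooksᵈ i j k (x ∷ y ∷ w) ≡ rooksᵈ i j k (y ∷ x ∷ w)
rooksᵈ-swap i j zero          x y w = refl
rooksᵈ-swap i j (suc zero)    x y w = ring (+ i) (+ j) (+ x) (+ y) (rooksᵈ (2 + i) j 1 w)
  where
  ring : ∀ i j x y r → r ℤ.+ (1ℤ ℤ.+ i ℤ.- y ℤ.- j) ℤ.* 1ℤ ℤ.+ (i ℤ.- x ℤ.- j) ℤ.* 1ℤ ≡
                       r ℤ.+ (1ℤ ℤ.+ i ℤ.- x ℤ.- j) ℤ.* 1ℤ ℤ.+ (i ℤ.- y ℤ.- j) ℤ.* 1ℤ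
  ring = solve-∀
rooksᵈ-swap i j (suc (suc k)) x y w =
  ring (+ i) (+ j) (+ x) (+ y) (rooksᵈ (2 + i) j (2 + k) w) (rooksᵈ (2 + i) (1 + j) (1 + k) w) (rooksᵈ (2 + i) (2 + j) k w)
  where
  ring : ∀ i j x y r s t →
    r ℤ.+ (1ℤ ℤ.+ i ℤ.- y ℤ.- j) ℤ.* s ℤ.+ (i ℤ.- x ℤ.- j) ℤ.* (s ℤ.+ (1ℤ ℤ.+ i ℤ.- y ℤ.- (1ℤ ℤ.+ j)) ℤ.* t) ≡
    r ℤ.+ (1ℤ ℤ.+ i ℤ.- x ℤ.- j) ℤ.* s ℤ.+ (i ℤ.- y ℤ.- j) ℤ.* (s ℤ.+ (1ℤ ℤ.+ i ℤ.- x ℤ.- (1ℤ ℤ.+ j)) ℤ.* t)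
  ring = solve-∀

rooksᵈ-∷ : ∀ x {v w} → (∀ i j k → rooksᵈ i j k v ≡ rooksᵈ i j k w) →
           ∀ i j k → rooksᵈ i j k (x ∷ v) ≡ rooksᵈ i j k (x ∷ w)
rooksᵈ-∷ x eq i j zero    = refl
rooksᵈ-∷ x eq i j (suc k) = cong₂ (λ r s → r ℤ.+ (+ i ℤ.- + x ℤ.- + j) ℤ.* s) (eq (suc i) j (suc k)) (eq (suc i) (suc j) k)

-- Adjacent swaps generate all permutations, so the multiset of letters determines every rook
-- number.
rooksᵈ-↭ : ∀ {v w} → v ↭ w → ∀ i j k → rooksᵈ i j k v ≡ rooksᵈ i j k w
rooksᵈ-↭ Perm.refl        i j k = refl
rooksᵈ-↭ (prep x π)       i j k = rooksᵈ-∷ x (rooksᵈ-↭ π) i j k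
rooksᵈ-↭ (swap x y π)     i j k = trans (rooksᵈ-swap i j k x y _) (rooksᵈ-∷ y (rooksᵈ-∷ x (rooksᵈ-↭ π)) i j k)
rooksᵈ-↭ (Perm.trans π ρ) i j k = trans (rooksᵈ-↭ π i j k) (rooksᵈ-↭ ρ i j k)

-- With x + y fixed, the second rook number determines the product x y.
rooksᵈ-transfer : ∀ {x y x′ y′ w} → x + y ≡ x′ + y′ → x ≢ x′ →
                  rooksᵈ 0 0 2 (x ∷ y ∷ w) ≡ rooksᵈ 0 0 2 (x′ ∷ y′ ∷ w) → y ≡ x′ × y′ ≡ x
rooksᵈ-transfer {x} {y} {x′} {y′} {w} x+y x≢x′ eq = y≡x′ , y′≡x
  where
  open ≡-Reasoning
  r = rooksᵈ 2 0 2 w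
  s = rooksᵈ 2 1 1 w
  -- `F x y` is `rooksᵈ 0 0 2 (x ∷ y ∷ w)` unfolded, with integer letters.
  F : ℤ → ℤ → ℤ
  F x y = r ℤ.+ (1ℤ ℤ.+ 0ℤ ℤ.- y ℤ.- 0ℤ) ℤ.* s ℤ.+ (0ℤ ℤ.- x ℤ.- 0ℤ) ℤ.* (s ℤ.+ (1ℤ ℤ.+ 0ℤ ℤ.- y ℤ.- 1ℤ) ℤ.* 1ℤ)
  -- With `y′` replaced by `x + y − x′`, the difference of the two rook numbers factors.
  ring : ∀ x y x′ r s → (x ℤ.- x′) ℤ.* (y ℤ.- x′) ≡
    (r ℤ.+ (1ℤ ℤ.+ 0ℤ ℤ.- y ℤ.- 0ℤ) ℤ.* s ℤ.+ (0ℤ ℤ.- x ℤ.- 0ℤ) ℤ.* (s ℤ.+ (1ℤ ℤ.+ 0ℤ ℤ.- y ℤ.- 1ℤ) ℤ.* 1ℤ)) ℤ.-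
    (r ℤ.+ (1ℤ ℤ.+ 0ℤ ℤ.- (x ℤ.+ y ℤ.- x′) ℤ.- 0ℤ) ℤ.* s ℤ.+ (0ℤ ℤ.- x′ ℤ.- 0ℤ) ℤ.* (s ℤ.+ (1ℤ ℤ.+ 0ℤ ℤ.- (x ℤ.+ y ℤ.- x′) ℤ.- 1ℤ) ℤ.* 1ℤ))
  ring = solve-∀
  cancel : ∀ x y → x ℤ.+ y ℤ.- x ≡ y
  cancel = solve-∀
  product : (+ x ℤ.- + x′) ℤ.* (+ y ℤ.- + x′) ≡ 0ℤ
  product = begin
    (+ x ℤ.- + x′) ℤ.* (+ y ℤ.- + x′)                 ≡⟨ ring (+ x) (+ y) (+ x′) r s ⟩
    F (+ x) (+ y) ℤ.- F (+ x′) (+ (x + y) ℤ.- + x′)   ≡⟨ cong (λ n → F (+ x) (+ y) ℤ.- F (+ x′) (+ n ℤ.- + x′)) x+y ⟩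
    F (+ x) (+ y) ℤ.- F (+ x′) (+ (x′ + y′) ℤ.- + x′) ≡⟨ cong (λ z → F (+ x) (+ y) ℤ.- F (+ x′) z) (cancel (+ x′) (+ y′)) ⟩
    F (+ x) (+ y) ℤ.- F (+ x′) (+ y′)                 ≡⟨ ℤ.i≡j⇒i-j≡0 eq ⟩
    0ℤ                                                ∎
  y≡x′ : y ≡ x′
  y≡x′ with ℤ.i*j≡0⇒i≡0∨j≡0 (+ x ℤ.- + x′) product
  ... | inj₁ p = contradiction (ℤ.+-injective (ℤ.i-j≡0⇒i≡j (+ x) (+ x′) p)) x≢x′
  ... | inj₂ p = ℤ.+-injective (ℤ.i-j≡0⇒i≡j (+ y) (+ x′) p)
  y′≡x : y′ ≡ x
  y′≡x = sym (+-cancelˡ-≡ x′ x y′ (trans (+-comm x′ x) (trans (cong (_+_ x) (sym y≡x′)) x+y)))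

-- Hamming distance

opaque
  mismatch : ℕ → ℕ → ℕ
  mismatch x y = if does (x ≟ y) then 0 else 1

  mismatch-refl : ∀ x → mismatch x x ≡ 0
  mismatch-refl x rewrite dec-true (x ≟ x) refl = refl

  mismatch-≢ : ∀ {x y} → x ≢ y → mismatch x y ≡ 1
  mismatch-≢ {x} {y} x≢y rewrite dec-false (x ≟ y) x≢y = refl

  -- Counting stops at the end of the shorter word; wherever a distance yields an equality, the
  -- lengths are required to agree.
  hamming : List ℕ → List ℕ → ℕ
  hamming (x ∷ u) (y ∷ v) = mismatch x y + hamming u v
  hamming _       _       = 0

  hamming-refl : ∀ u → hamming u u ≡ 0
  hamming-refl []      = refl
  hamming-refl (x ∷ u) rewrite mismatch-refl x = hamming-refl u

  hamming-∷ : ∀ x u v → hamming (x ∷ u) (x ∷ v) ≡ hamming u v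
  hamming-∷ x u v rewrite mismatch-refl x = refl

  hamming-∷-≢ : ∀ {x y} u v → x ≢ y → hamming (x ∷ u) (y ∷ v) ≡ suc (hamming u v)
  hamming-∷-≢ u v x≢y rewrite mismatch-≢ x≢y = refl

  hamming-sym : ∀ u v → hamming u v ≡ hamming v u
  hamming-sym []      []      = refl
  hamming-sym []      (_ ∷ _) = refl
  hamming-sym (_ ∷ _) []      = refl
  hamming-sym (x ∷ u) (y ∷ v) with x ≟ y
  ... | yes refl = trans (hamming-∷ x u v) (trans (hamming-sym u v) (sym (hamming-∷ x v u)))
  ... | no x≢y   = trans (hamming-∷-≢ u v x≢y)
                     (trans (cong suc (hamming-sym u v)) (sym (hamming-∷-≢ v u (≢-sym x≢y))))

  hamming-++ : ∀ p q {u v} → length p ≡ length q →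
               hamming (p ++ u) (q ++ v) ≡ hamming p q + hamming u v
  hamming-++ []      []      _  = refl
  hamming-++ (x ∷ p) (y ∷ q) eq =
    trans (cong (_+_ (mismatch x y)) (hamming-++ p q (suc-injective eq))) (sym (+-assoc (mismatch x y) _ _))

  hamming-++ˡ : ∀ p {u v} → hamming (p ++ u) (p ++ v) ≡ hamming u v
  hamming-++ˡ p = trans (hamming-++ p p refl) (cong (_+ _) (hamming-refl p))

  hamming-++ʳ : ∀ p q {u} → length p ≡ length q → hamming (p ++ u) (q ++ u) ≡ hamming p q
  hamming-++ʳ p q {u} eq = trans (hamming-++ p q eq) (trans (cong (_+_ (hamming p q)) (hamming-refl u)) (+-identityʳ _))

  hamming≡0⇒≡ : ∀ u v → length u ≡ length v → hamming u v ≡ 0 → u ≡ v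
  hamming≡0⇒≡ []      []      _  _ = refl
  hamming≡0⇒≡ (x ∷ u) (y ∷ v) eq h with x ≟ y
  ... | yes refl = cong (x ∷_) (hamming≡0⇒≡ u v (suc-injective eq) (trans (sym (hamming-∷ x u v)) h))
  ... | no x≢y   with () ← trans (sym (hamming-∷-≢ u v x≢y)) h

-- Depth sequences of plane forests

-- The depth sequences, in preorder, of plane forests with roots at depth a;
-- u bounds the depth of the next node.
data Depths (a : ℕ) : ℕ → List ℕ → Set where
  []   : ∀ {u} → Depths a u []
  node : ∀ {u x w} → a ≤ x → x ≤ u → Depths a (suc x) w → Depths a u (x ∷ w)

Depths-weaken : ∀ {a u u′ w} → u ≤ u′ → Depths a u w → Depths a u′ w
Depths-weaken u≤u′ []              = []
Depths-weaken u≤u′ (node a≤x x≤u d) = node a≤x (≤-trans x≤u u≤u′) d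

Depths-lower : ∀ {a u w} → Depths (suc a) u w → Depths a u w
Depths-lower []              = []
Depths-lower (node a<x x≤u d) = node (<⇒≤ a<x) x≤u (Depths-lower d)

Depths-raise : ∀ {a u w} → All (a <_) w → Depths a u w → Depths (suc a) u w
Depths-raise _            []            = []
Depths-raise (a<x ∷ a<w) (node _ x≤u d) = node a<x x≤u (Depths-raise a<w d)

Depths⇒All : ∀ {a u w} → Depths a u w → All (a ≤_) w
Depths⇒All []            = []
Depths⇒All (node a≤x _ d) = a≤x ∷ Depths⇒All d

Depths-++⁺ : ∀ {a u v w} → a ≤ u → Depths a u v → Depths a a w → Depths a u (v ++ w)
Depths-++⁺ a≤u []              e = Depths-weaken a≤u e
Depths-++⁺ _   (node a≤x x≤u d) e = node a≤x x≤u (Depths-++⁺ (m≤n⇒m≤1+n a≤x) d e)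

Depths-++⁻ˡ : ∀ {a u} v {w} → Depths a u (v ++ w) → Depths a u v
Depths-++⁻ˡ []      _               = []
Depths-++⁻ˡ (x ∷ v) (node a≤x x≤u d) = node a≤x x≤u (Depths-++⁻ˡ v d)

Depths-suffix : ∀ {a u} v {x w} → Depths a u (v ++ x ∷ w) → Depths a (suc x) w
Depths-suffix []      (node _ _ d) = d
Depths-suffix (_ ∷ v) (node _ _ d) = Depths-suffix v d

-- The letter after a root is at most `suc a`, which any preceding letter also allows; `suc a ≤ u`
-- covers the case where nothing precedes.
Depths-delete : ∀ {a u} v {w} → suc a ≤ u → Depths a u (v ++ a ∷ w) → Depths a u (v ++ w)
Depths-delete []      a<u (node _ _ d)     = Depths-weaken a<u d
Depths-delete (x ∷ v) a<u (node a≤x x≤u d) = node a≤x x≤u (Depths-delete v (s≤s a≤x) d)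

Depths-root : ∀ {a x w} → Depths a a (x ∷ w) → x ≡ a
Depths-root (node a≤x x≤a _) = ≤-antisym x≤a a≤x

-- No step between these letters goes up by more than 1, so every arrangement is a depth sequence.
Depths-two-letters : ∀ {a u w} → suc a ≤ u → All (λ x → x ≡ a ⊎ x ≡ suc a) w → Depths a u w
Depths-two-letters _   []              = []
Depths-two-letters a<u (inj₁ refl ∷ l) = node ≤-refl (<⇒≤ a<u) (Depths-two-letters ≤-refl l)
Depths-two-letters a<u (inj₂ refl ∷ l) = node (n≤1+n _) a<u (Depths-two-letters (n≤1+n _) l)

Depths-replicate : ∀ a n → Depths a a (replicate n a)
Depths-replicate a zero    = []
Depths-replicate a (suc n) = node ≤-refl ≤-refl (Depths-weaken (n≤1+n a) (Depths-replicate a n))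

Depths-∷ : ∀ {a w} → Depths a (suc a) w → Depths a a (a ∷ w)
Depths-∷ d = node ≤-refl ≤-refl d

-- v is w without its roots: deleting the roots of a forest leaves a forest.
Depths-split : ∀ {a u u′ w} → u ≤ u′ → suc a ≤ u′ → Depths a u w →
               ∃[ n ] ∃[ v ] Depths (suc a) u′ v × w ↭ replicate n a ++ v
Depths-split _ _ [] = 0 , [] , [] , ↭-refl
Depths-split {a} u≤u′ a<u′ (node {x = x} {w = w} a≤x x≤u d) with a ≟ x
-- The deleted root allowed letters up to `suc a`; `u′` still allows them.
... | yes refl with n , v , e , π ← Depths-split {w = w} a<u′ a<u′ d = suc n , v , e , prep a π
... | no a≢x with n , v , e , π ← Depths-split {w = w} ≤-refl (m≤n⇒m≤1+n (≤∧≢⇒< a≤x a≢x)) d =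
  n , x ∷ v , node (≤∧≢⇒< a≤x a≢x) (≤-trans x≤u u≤u′) e ,
  ↭-trans (prep x π) (↭-sym (shift x (replicate n a) v))

above⇒∉ : ∀ {a w} → All (a <_) w → a ∉ w
above⇒∉ a<w a∈w = <-irrefl refl (All.lookup a<w a∈w)

∈⇒delete : ∀ {a : ℕ} {w v} → a ∈ w → w ↭ a ∷ v →
           ∃[ p ] ∃[ q ] w ≡ p ++ a ∷ q × p ++ q ↭ v
∈⇒delete a∈w π with p , q , refl ← ∈-∃++ a∈w = p , q , refl , drop-mid p [] π

++-cancelˡ-↭ : ∀ (u : List ℕ) {v w} → u ++ v ↭ u ++ w → v ↭ w
++-cancelˡ-↭ []      π = π
++-cancelˡ-↭ (x ∷ u) π = ++-cancelˡ-↭ u (drop-∷ π)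

All-≡⇒≡ : ∀ {a : ℕ} {u v} → All (_≡ a) u → All (_≡ a) v → length u ≡ length v → u ≡ v
All-≡⇒≡ []       []       _  = refl
All-≡⇒≡ (refl ∷ p) (refl ∷ q) eq = cong (_ ∷_) (All-≡⇒≡ p q (suc-injective eq))

-- Rotating past a smaller letter

-- The letter `a` occurs on the left only.
∷ʳ≢∷ : ∀ {a x} v → All (a <_) v → a < x → v ++ [ a ] ≢ x ∷ v
∷ʳ≢∷ []      _           a<x refl = <-irrefl refl a<x
∷ʳ≢∷ (y ∷ v) (a<y ∷ a<v) _   eq with refl , eq′ ← ∷-injective eq = ∷ʳ≢∷ v a<v a<y eq′

length-∷ʳ : ∀ (v : List ℕ) {a} → length (v ++ [ a ]) ≡ suc (length v)
length-∷ʳ []      = refl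
length-∷ʳ (_ ∷ v) = cong suc (length-∷ʳ v)

-- If the first letters differed, this would be the only mismatch, and the rest would contradict
-- `∷ʳ≢∷`. So they agree, and the same `x` is compared with the next letter.
shift≡1⇒constant : ∀ {a x} v → All (a <_) v → hamming (v ++ [ a ]) (x ∷ v) ≡ 1 → All (_≡ x) v
shift≡1⇒constant []      _           _ = []
shift≡1⇒constant {x = x} (y ∷ v) (a<y ∷ a<v) h with y ≟ x
... | yes refl = refl ∷ shift≡1⇒constant v a<v (trans (sym (hamming-∷ y _ _)) h)
... | no y≢x   = contradiction
  (hamming≡0⇒≡ _ _ (length-∷ʳ v) (suc-injective (trans (sym (hamming-∷-≢ _ _ y≢x)) h)))
  (∷ʳ≢∷ v a<v a<y)

-- A forest starts with a root, here `suc a`, which already differs from `a`; one mismatch is left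
-- for the shifted remainder.
rotation≡2⇒constant : ∀ {a v} → Depths (suc a) (suc a) v →
                      hamming (v ++ [ a ]) (a ∷ v) ≡ 2 → All (_≡ suc a) v
rotation≡2⇒constant [] _ = []
rotation≡2⇒constant {a} {x ∷ v} d@(node a<x _ e) h with refl ← Depths-root d =
  refl ∷ shift≡1⇒constant v (Depths⇒All e) (suc-injective (trans (sym (hamming-∷-≢ _ _ (≢-sym (<⇒≢ a<x)))) h))

-- Both mismatches are used up where `a` meets a larger letter, at the two ends, so the words agree
-- in between.
rotation≡2⇒rotated : ∀ {a x v w} → All (a <_) (x ∷ v) → All (a <_) w → x ∷ v ↭ w →
                     hamming (x ∷ v ++ [ a ]) (a ∷ w) ≡ 2 → w ≡ v ++ [ x ]
rotation≡2⇒rotated {a} {x} {v} {w} (a<x ∷ a<v) a<w π h with initLast w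
... | [] with () ← ↭-length π
... | w′ ∷ʳ′ y = cong₂ (λ s z → s ++ [ z ]) (sym v≡w′) (sym x≡y)
  where
  open ≡-Reasoning
  |v|≡|w′| : length v ≡ length w′
  |v|≡|w′| = suc-injective (trans (↭-length π) (length-∷ʳ w′))
  a<y : a < y
  a<y with a<y′ ∷ [] ← All.++⁻ʳ w′ a<w = a<y′
  v≡w′ : v ≡ w′
  v≡w′ = hamming≡0⇒≡ v w′ |v|≡|w′| (+-cancelʳ-≡ 1 (hamming v w′) 0 (suc-injective (begin
    suc (hamming v w′ + 1)                       ≡⟨ cong (λ n → suc (hamming v w′ + n)) (trans (hamming-∷-≢ [] [] (<⇒≢ a<y)) (cong suc (hamming-refl []))) ⟨
    suc (hamming v w′ + hamming [ a ] [ y ])     ≡⟨ cong suc (hamming-++ v w′ |v|≡|w′|) ⟨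
    suc (hamming (v ++ [ a ]) (w′ ++ [ y ]))     ≡⟨ hamming-∷-≢ _ _ (≢-sym (<⇒≢ a<x)) ⟨
    hamming (x ∷ v ++ [ a ]) (a ∷ w′ ++ [ y ])   ≡⟨ h ⟩
    2                                            ∎)))
  x≡y : x ≡ y
  x≡y = ∷-injectiveˡ (↭-singleton-inv (++-cancelˡ-↭ v
    (↭-trans (++-comm v [ x ]) (↭-trans π (↭-reflexive (cong (_++ [ y ]) (sym v≡w′)))))))

rotate²≡id⇒constant : ∀ {b : ℕ} v → b ∷ b ∷ v ≡ (v ++ [ b ]) ++ [ b ] → All (_≡ b) v
rotate²≡id⇒constant []      _  = []
rotate²≡id⇒constant (x ∷ v) eq with refl , eq′ ← ∷-injective eq = refl ∷ rotate²≡id⇒constant v eq′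

↭-pair-inv : ∀ {x y : ℕ} {w} → w ↭ x ∷ y ∷ [] → w ≡ x ∷ y ∷ [] ⊎ w ≡ y ∷ x ∷ []
↭-pair-inv π with p , q , refl , ρ ← ∈⇒delete (∈-resp-↭ (↭-sym π) (here refl)) π
  with p | ↭-singleton-inv ρ
... | []     | refl = inj₁ refl
... | _ ∷ [] | refl = inj₂ refl

hamming-swap : ∀ {x y} → x ≢ y → ∀ w → hamming (x ∷ y ∷ w) (y ∷ x ∷ w) ≡ 2
hamming-swap x≢y w = trans (hamming-∷-≢ _ _ x≢y)
  (cong suc (trans (hamming-∷-≢ _ _ (≢-sym x≢y)) (cong suc (hamming-refl w))))

-- K₂,₂ is not realised by depth sequences

≡⊎≡not : ∀ s t → t ≡ s ⊎ t ≡ not s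
≡⊎≡not false false = inj₁ refl
≡⊎≡not false true  = inj₂ refl
≡⊎≡not true  false = inj₂ refl
≡⊎≡not true  true  = inj₁ refl

-- The first argument of vert is the side of K₂,₂ on which the vertex lies.
record Square (a : ℕ) (M : List ℕ) : Set where
  field
    vert     : Bool → Bool → List ℕ
    depths   : ∀ s t → Depths a a (vert s t)
    perm     : ∀ s t → vert s t ↭ M
    complete : ∀ {w} → Depths a a w → w ↭ M → ∃[ s ] ∃[ t ] w ≡ vert s t
    cross    : ∀ s t t′ → hamming (vert s t) (vert (not s) t′) ≡ 2
    same     : ∀ s t t′ → hamming (vert s t) (vert s t′) ≢ 2
    distinct : ∀ s t → vert s t ≢ vert s (not t)

  vert-injective : ∀ s t s′ t′ → vert s t ≡ vert s′ t′ → s′ ≡ s × t′ ≡ t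
  vert-injective s t s′ t′ eq with ≡⊎≡not s s′ | ≡⊎≡not t t′
  ... | inj₁ refl | inj₁ refl = refl , refl
  ... | inj₁ refl | inj₂ refl = contradiction eq (distinct s t)
  ... | inj₂ refl | _
    with () ← trans (sym (cross s t t′)) (trans (cong (hamming _) (sym eq)) (hamming-refl _))

  -- Non-adjacent vertices lie on the same side, and a side has only two vertices.
  opposite : ∀ {u v} → Depths a a u → u ↭ M → Depths a a v → v ↭ M →
             hamming u v ≢ 2 → u ≢ v → ∃[ s ] ∃[ t ] u ≡ vert s t × v ≡ vert s (not t)
  opposite d π e ρ h≢2 u≢v with complete d π | complete e ρ
  ... | s , t , refl | s′ , t′ , refl with ≡⊎≡not s s′ | ≡⊎≡not t t′
  ... | inj₁ refl | inj₁ refl = contradiction refl u≢v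
  ... | inj₁ refl | inj₂ refl = s , t , refl , refl
  ... | inj₂ refl | _         = contradiction (cross s t t′) h≢2

  -- Of three vertices, two lie on the same side.
  no-triangle : ∀ {u v w} → Depths a a u → u ↭ M → Depths a a v → v ↭ M → Depths a a w → w ↭ M →
                hamming u v ≡ 2 → hamming u w ≡ 2 → hamming v w ≡ 2 → ⊥
  no-triangle d π e ρ f σ uv uw vw with complete d π | complete e ρ | complete f σ
  ... | s , t , refl | s′ , t′ , refl | s″ , t″ , refl with ≡⊎≡not s s′ | ≡⊎≡not s s″
  ... | inj₁ refl | _         = same s t t′ uv
  ... | inj₂ refl | inj₁ refl = same s t t″ uw
  ... | inj₂ refl | inj₂ refl = same (not s) t′ t″ vw

module _ {a M} (K : Square a M) where
  open Square K

  vert-root : ∀ s t {m} → M ↭ a ∷ m → ∃[ w ] vert s t ≡ a ∷ w × w ↭ m × Depths a (suc a) w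
  vert-root s t {m} μ with vert s t in eq | depths s t | perm s t
  ... | []    | _ | π with () ← ↭-length (↭-trans π μ)
  ... | x ∷ w | d@(node _ _ e) | π with refl ← Depths-root d =
    w , refl , drop-∷ (↭-trans π μ) , e

  -- The words `a x x y z`, `a x y x z` and `a y x x z` form a triangle.
  ¬three-letters : ∀ {x y z} → x ≢ y → All (λ l → l ≡ a ⊎ l ≡ suc a) (x ∷ y ∷ z) →
                   ¬ (M ↭ a ∷ x ∷ x ∷ y ∷ z)
  ¬three-letters {x} {y} {z} x≢y (X ∷ Y ∷ Z) μ = no-triangle
    (word (X ∷ X ∷ Y ∷ Z)) (↭-sym μ)
    (word (X ∷ Y ∷ X ∷ Z)) (↭-trans (prep a (prep x (swap y x ↭-refl))) (↭-sym μ))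
    (word (Y ∷ X ∷ X ∷ Z)) (↭-trans (prep a (↭-sym (shift y (x ∷ x ∷ []) z))) (↭-sym μ))
    (trans (hamming-++ˡ (a ∷ x ∷ [])) (hamming-swap x≢y z))
    (trans (hamming-∷ a _ _) (trans (hamming-∷-≢ _ _ x≢y) (cong suc
      (trans (hamming-∷ x _ _) (trans (hamming-∷-≢ _ _ (≢-sym x≢y)) (cong suc (hamming-refl z)))))))
    (trans (hamming-∷ a _ _) (hamming-swap x≢y (x ∷ z)))
    where
    word : ∀ {w} → All (λ l → l ≡ a ⊎ l ≡ suc a) w → Depths a a (a ∷ w)
    word l = Depths-∷ (Depths-two-letters ≤-refl l)

  ¬constant : ¬ All (_≡ a) M
  ¬constant c = distinct true true (All-≡⇒≡ (letters true) (letters false)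
    (trans (↭-length (perm true true)) (sym (↭-length (perm true false)))))
    where
    letters : ∀ t → All (_≡ a) (vert true t)
    letters t = All-resp-↭ (↭-sym (perm true t)) c

  -- The only words are `a a b` and `a b a` with `b = suc a`. They are adjacent, so they cannot fill
  -- a side.
  ¬two-words : ¬ (M ↭ a ∷ a ∷ suc a ∷ [])
  ¬two-words μ with vert-root true true μ | vert-root true false μ
  ... | v , p , π , _ | w , q , ρ , _ with ↭-pair-inv π | ↭-pair-inv ρ
  ... | inj₁ refl | inj₁ refl = distinct true true (trans p (sym q))
  ... | inj₂ refl | inj₂ refl = distinct true true (trans p (sym q))
  ... | inj₁ refl | inj₂ refl = same true true false (trans (cong₂ hamming p q)
    (trans (hamming-∷ a _ _) (hamming-swap (<⇒≢ ≤-refl) [])))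
  ... | inj₂ refl | inj₁ refl = same true true false (trans (cong₂ hamming p q)
    (trans (hamming-∷ a _ _) (hamming-swap (≢-sym (<⇒≢ ≤-refl)) [])))

  ¬two-letters : ∀ n {v} → All (_≡ suc a) v → ¬ (M ↭ a ∷ replicate (suc n) a ++ v)
  ¬two-letters n       []            μ = ¬constant (All-resp-↭ (↭-sym μ)
    (refl ∷ All.++⁺ (All.replicate⁺ (suc n) refl) []))
  ¬two-letters zero    (refl ∷ [])         μ = ¬two-words μ
  -- Behind the first root the repeated letter of the triangle is `suc a` here and `a` in the next
  -- clause.
  ¬two-letters zero    (refl ∷ refl ∷ c) μ = ¬three-letters (≢-sym (<⇒≢ ≤-refl))
    (inj₂ refl ∷ inj₁ refl ∷ All.map inj₂ c) (↭-trans μ (prep a (↭-sym (shift a (suc a ∷ suc a ∷ []) _))))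
  ¬two-letters (suc n) {_ ∷ v} (refl ∷ c)  μ = ¬three-letters (<⇒≢ ≤-refl)
    (inj₁ refl ∷ inj₂ refl ∷ All.++⁺ (All.replicate⁺ n (inj₁ refl)) (All.map inj₂ c))
    (↭-trans μ (prep a (prep a (prep a (shift (suc a) (replicate n a) v)))))

  module _ {v} (δ : Depths (suc a) (suc a) v) (¬c : ¬ All (_≡ suc a) v) where

    ¬leading-root : ∀ {w w′} → v ++ w ≢ a ∷ w′
    ¬leading-root {w} {w′} = go δ ¬c
      where
      go : ∀ {v} → Depths (suc a) (suc a) v → ¬ All (_≡ suc a) v → v ++ w ≢ a ∷ w′
      go []             ¬c _  = ¬c []
      go (node a<x _ _) _  eq = <⇒≢ a<x (sym (∷-injectiveˡ eq))

    block : ∀ {z} → Depths a a z → Depths a (suc a) (v ++ z)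
    block ε = Depths-++⁺ (n≤1+n a) (Depths-lower δ) ε

    -- The common parts `p` and `z` do not affect the distance, so it is that of `v a` and `a v`. It
    -- is not 2 because `v` is not constant, and the words differ because `v` does not begin with
    -- `a`.
    opposite-rotations : ∀ p z → Depths a a (p ++ v ++ a ∷ z) → Depths a a (p ++ a ∷ v ++ z) →
                         M ↭ p ++ a ∷ v ++ z →
                         ∃[ s ] ∃[ t ] p ++ v ++ a ∷ z ≡ vert s t × p ++ a ∷ v ++ z ≡ vert s (not t)
    opposite-rotations p z d e μ =
      opposite d (↭-trans (++⁺ˡ p (shift a v z)) (↭-sym μ)) e (↭-sym μ)
        (λ h → ¬c (rotation≡2⇒constant δ (trans (sym rotated) h)))
        (λ eq → ¬leading-root (++-cancelˡ p _ _ eq))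
      where
      rotated : hamming (p ++ v ++ a ∷ z) (p ++ a ∷ v ++ z) ≡ hamming (v ++ [ a ]) (a ∷ v)
      rotated = begin
        hamming (p ++ v ++ a ∷ z) (p ++ a ∷ v ++ z)   ≡⟨ hamming-++ˡ p ⟩
        hamming (v ++ a ∷ z) (a ∷ v ++ z)             ≡⟨ cong (λ w → hamming w (a ∷ v ++ z)) (∷ʳ-++ v a z) ⟨
        hamming ((v ++ [ a ]) ++ z) ((a ∷ v) ++ z)    ≡⟨ hamming-++ʳ (v ++ [ a ]) (a ∷ v) (length-∷ʳ v) ⟩
        hamming (v ++ [ a ]) (a ∷ v)                  ∎
        where open ≡-Reasoning

  -- Of the pairwise non-adjacent words a v a a …, a a v a … and a a a v …, the
  -- second has two non-neighbours.
  ¬three-roots : ∀ n {v} → Depths (suc a) (suc a) v → ¬ All (_≡ suc a) v →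
                 ¬ (M ↭ a ∷ replicate (suc (suc n)) a ++ v)
  ¬three-roots n {v} δ ¬c μ = contradict
    (opposite-rotations δ ¬c [ a ] (a ∷ z)
      (Depths-∷ (block δ ¬c (Depths-∷ (tail ζ)))) (Depths-∷ (tail (block δ ¬c (Depths-∷ ζ))))
      (↭-trans μ (prep a (prep a (++-comm (a ∷ z) v)))))
    (opposite-rotations δ ¬c (a ∷ a ∷ []) z
      (Depths-∷ (tail (block δ ¬c (Depths-∷ ζ)))) (Depths-∷ (tail (tail (block δ ¬c ζ₀))))
      (↭-trans μ (prep a (prep a (prep a (++-comm z v))))))
    where
    z : List ℕ
    z = replicate n a
    ζ₀ : Depths a a z
    ζ₀ = Depths-replicate a n
    ζ : Depths a (suc a) z
    ζ = Depths-weaken (n≤1+n a) ζ₀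
    tail : ∀ {w} → Depths a (suc a) w → Depths a (suc a) (a ∷ w)
    tail = node ≤-refl (n≤1+n a)
    contradict : (∃[ s ] ∃[ t ] a ∷ v ++ a ∷ a ∷ z ≡ vert s t × a ∷ a ∷ v ++ a ∷ z ≡ vert s (not t)) →
                 (∃[ s ] ∃[ t ] a ∷ a ∷ v ++ a ∷ z ≡ vert s t × a ∷ a ∷ a ∷ v ++ z ≡ vert s (not t)) → ⊥
    contradict (s , t , p , q) (s′ , t′ , p′ , q′)
      -- The word `a a v a …` lies in both pairs, and the other vertex of its side is unique. So
      -- `a v a a …` and `a a a v …` coincide, and `v` would begin with `a`.
      with refl , refl ← vert-injective s (not t) s′ t′ (trans (sym q) p′) =
      ¬leading-root δ ¬c (∷-injectiveʳ (trans p (trans (cong (vert s) (sym (not-involutive t))) (sym q′))))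

  ¬two-roots : ∀ {v} → Depths (suc a) (suc a) v → ¬ All (_≡ suc a) v → ¬ (M ↭ a ∷ a ∷ v)
  ¬two-roots {v} δ ¬c μ = contradict₁ (rotations δ ↭-refl)
    where
    b : ℕ
    b = suc a

    above : ∀ {w} → w ↭ v → All (a <_) w
    above π = All-resp-↭ (↭-sym π) (Depths⇒All δ)

    ¬c-resp : ∀ {w} → w ↭ v → ¬ All (_≡ b) w
    ¬c-resp π c = ¬c (All-resp-↭ π c)

    Rotations : Bool → Bool → List ℕ → Set
    Rotations s t w = a ∷ w ++ [ a ] ≡ vert s t × a ∷ a ∷ w ≡ vert s (not t)

    rotations : ∀ {w} → Depths b b w → w ↭ v → ∃[ s ] ∃[ t ] Rotations s t w
    rotations {w} ε π
      with s , t , p , q ← opposite-rotations ε (¬c-resp π) [ a ] []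
        (Depths-∷ (block ε (¬c-resp π) (Depths-replicate a 1)))
        (Depths-∷ (node ≤-refl (n≤1+n a) (block ε (¬c-resp π) [])))
        (↭-trans μ (prep a (prep a (↭-trans (↭-sym π) (↭-reflexive (sym (++-identityʳ w)))))))
      = s , t , p , trans (cong (λ u → a ∷ a ∷ u) (sym (++-identityʳ w))) q

    -- If C = a x a y were adjacent to both rotations of v = x y, then x and y,
    -- and so v, would be constant.
    ¬insertion : ∀ x y → Depths a b (x ++ a ∷ y) → v ≡ x ++ y →
                 hamming (v ++ [ a ]) (x ++ a ∷ y) ≡ 2 → hamming (a ∷ v) (x ++ a ∷ y) ≡ 2 → ⊥
    ¬insertion x y e refl h h′ = ¬c (All.++⁺ cx cy)
      where
      -- `a x y` and `x a y` agree on the final `y`, so both mismatches lie in `a x` against `x a`.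
      cx : All (_≡ b) x
      cx = rotation≡2⇒constant (Depths-++⁻ˡ x δ)
        (trans (hamming-sym (x ++ [ a ]) (a ∷ x)) (trans
          (sym (trans (cong (hamming (a ∷ x ++ y)) (sym (∷ʳ-++ x a y)))
                      (hamming-++ʳ (a ∷ x) (x ++ [ a ]) (sym (length-∷ʳ x))))) h′))
      -- In `C` the letters of `y` follow a root and include none, so they form a forest one level
      -- deeper.
      cy : All (_≡ b) y
      cy = rotation≡2⇒constant (Depths-raise (All.++⁻ʳ x (Depths⇒All δ)) (Depths-suffix x e))
        (trans (sym (trans (cong (λ u → hamming u (x ++ a ∷ y)) (++-assoc x y [ a ])) (hamming-++ˡ x))) h)

    -- Rotation by one letter takes `v` to `w` and `w` to `v`. Both start with the root `b`, so each
    -- rotation moves a `b` to the end, and comparing letters makes `v` constant.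
    ¬rotated : ∀ {w} → Depths b b w → w ↭ v →
               hamming (v ++ [ a ]) (a ∷ w) ≡ 2 → hamming (a ∷ v) (w ++ [ a ]) ≡ 2 → ⊥
    ¬rotated {w} ε π h h′ = constant δ ε refl refl
      where
      constant : ∀ {v′ w′} → Depths b b v′ → Depths b b w′ → v′ ≡ v → w′ ≡ w → ⊥
      constant []        _   refl _    = ¬c []
      constant (node _ _ _) [] refl refl with () ← ↭-length π
      constant {x ∷ v′} {y ∷ w′} ε₁ ε₂ refl refl with refl ← Depths-root ε₁ | refl ← Depths-root ε₂ =
        ¬c (finish v′ (rotation≡2⇒rotated (above ↭-refl) (above π) (↭-sym π) h)
          (rotation≡2⇒rotated (above π) (above ↭-refl) π (trans (hamming-sym _ (a ∷ v)) h′)))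
        where
        finish : ∀ v′ → b ∷ w′ ≡ v′ ++ [ b ] → b ∷ v′ ≡ w′ ++ [ b ] → All (_≡ b) (b ∷ v′)
        finish []       _  _   = refl ∷ []
        finish (_ ∷ v″) eq eq′ with refl , refl ← ∷-injective eq = refl ∷ refl ∷ rotate²≡id⇒constant v″ eq′

    -- The rotations of `x ++ y` fill a side as well. If it is the side of the rotations of `v`,
    -- either corresponding ones coincide and `v ≡ x ++ y`, or `x ++ y` would begin with `a`. If it
    -- is the other side, every rotation of one is adjacent to every rotation of the other.
    contradict₂ : ∀ {s t w s′ t′} x y → Rotations s t v → vert (not s) true ≡ a ∷ w → w ≡ x ++ a ∷ y →
                  Depths a b w → x ++ y ↭ v → Rotations s′ t′ (x ++ y) → ⊥
    contradict₂ {s} {t} {s′ = s′} {t′} x y (p , q) r refl e ρ (p′ , q′) with ≡⊎≡not s s′ | ≡⊎≡not t t′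
    ... | inj₁ refl | inj₁ refl = ¬insertion x y e (∷ʳ-injectiveˡ v (x ++ y) (∷-injectiveʳ (trans p (sym p′))))
      (distance t p r) (distance (not t) q r)
      where
      distance : ∀ t {u u′} → a ∷ u ≡ vert s t → vert (not s) true ≡ a ∷ u′ → hamming u u′ ≡ 2
      distance t p r = trans (sym (hamming-∷ a _ _)) (trans (cong₂ hamming p (sym r)) (cross s t true))
    ... | inj₁ refl | inj₂ refl = ¬leading-root ε (¬c-resp ρ) (∷-injectiveʳ (trans p′ (sym q)))
      where ε = Depths-raise (above ρ) (Depths-delete x ≤-refl e)
    ... | inj₂ refl | _ = ¬rotated ε ρ (distance t (not t′) p q′) (distance (not t) t′ q p′)
      where
      ε = Depths-raise (above ρ) (Depths-delete x ≤-refl e)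
      distance : ∀ t t′ {u u′} → a ∷ u ≡ vert s t → a ∷ u′ ≡ vert (not s) t′ → hamming u u′ ≡ 2
      distance t t′ p r = trans (sym (hamming-∷ a _ _)) (trans (cong₂ hamming p r) (cross s t t′))

    contradict₁ : ∃[ s ] ∃[ t ] Rotations s t v → ⊥
    contradict₁ (s , t , R) with w , r , π , e ← vert-root (not s) true μ
      with x , y , refl , ρ ← ∈⇒delete (∈-resp-↭ (↭-sym π) (here refl)) π =
      contradict₂ x y R r refl e ρ (proj₂ (proj₂ (rotations (Depths-raise (above ρ) (Depths-delete x ≤-refl e)) ρ)))

  ¬repeated-root : ∀ {m} → M ↭ a ∷ m → Depths a (suc a) m → a ∉ m
  ¬repeated-root {m} μ d a∈m with Depths-split ≤-refl ≤-refl d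
  ... | zero  , v , ε , π = above⇒∉ (Depths⇒All ε) (∈-resp-↭ π a∈m)
  ... | suc n , v , ε , π with all? (_≟ suc a) v
  ...   | yes c = ¬two-letters n c (↭-trans μ (prep a π))
  ...   | no ¬c with n
  ...     | zero   = ¬two-roots ε ¬c (↭-trans μ (prep a π))
  ...     | suc n′ = ¬three-roots n′ ε ¬c (↭-trans μ (prep a π))

  -- The single root stands first in every word, so dropping it keeps all distances, and what is
  -- left is a forest one level deeper.
  remove-root : ∀ {m} → M ↭ a ∷ m → a ∉ m → All (a ≤_) m → Square (suc a) m
  remove-root {m} μ a∉m a≤m = record
    { vert     = vert′
    ; depths   = λ s t → Depths-raise (All-resp-↭ (↭-sym (perm′ s t)) a<m) (proj₂ (proj₂ (proj₂ (root s t))))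
    ; perm     = perm′
    ; complete = complete′
    ; cross    = λ s t t′ → trans (sym (hamming-vert s t (not s) t′)) (cross s t t′)
    ; same     = λ s t t′ h → same s t t′ (trans (hamming-vert s t s t′) h)
    ; distinct = λ s t eq → distinct s t (trans (vert≡ s t) (trans (cong (a ∷_) eq) (sym (vert≡ s (not t)))))
    }
    where
    root : ∀ s t → ∃[ w ] vert s t ≡ a ∷ w × w ↭ m × Depths a (suc a) w
    root s t = vert-root s t μ
    vert′ : Bool → Bool → List ℕ
    vert′ s t = proj₁ (root s t)
    vert≡ : ∀ s t → vert s t ≡ a ∷ vert′ s t
    vert≡ s t = proj₁ (proj₂ (root s t))
    perm′ : ∀ s t → vert′ s t ↭ m
    perm′ s t = proj₁ (proj₂ (proj₂ (root s t)))
    a<m : All (a <_) m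
    a<m = All.zipWith (λ (a≤x , a≢x) → ≤∧≢⇒< a≤x a≢x) (a≤m , All.¬Any⇒All¬ m a∉m)
    hamming-vert : ∀ s t s′ t′ → hamming (vert s t) (vert s′ t′) ≡ hamming (vert′ s t) (vert′ s′ t′)
    hamming-vert s t s′ t′ = trans (cong₂ hamming (vert≡ s t) (vert≡ s′ t′)) (hamming-∷ a _ _)
    complete′ : ∀ {w} → Depths (suc a) (suc a) w → w ↭ m → ∃[ s ] ∃[ t ] w ≡ vert′ s t
    complete′ d π with s , t , eq ← complete (Depths-∷ (Depths-lower d)) (↭-trans (prep a π) (↭-sym μ)) =
      s , t , ∷-injectiveʳ (trans eq (vert≡ s t))

-- Induction on the length: roots that occur once are stripped until a root is repeated or no letter
-- is left.
¬square : ∀ n {a M} → length M ≡ n → ¬ Square a M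
¬square n {a} |M| K with Square.vert K true true | Square.depths K true true | Square.perm K true true
... | []    | _ | π = ¬constant K (All-resp-↭ π [])
... | x ∷ m | d@(node _ _ e) | π with refl ← Depths-root d | n | a ∈? m
...   | _      | yes a∈m = ¬repeated-root K (↭-sym π) e a∈m
...   | zero   | no _    with () ← trans (↭-length π) |M|
...   | suc n′ | no a∉m  = ¬square n′ (suc-injective (trans (↭-length π) |M|))
  (remove-root K (↭-sym π) a∉m (Depths⇒All e))

-- Transfers between two letters

-- With `Transfer`, this is a list form of `Exchange` that does not record which entry grows. `c`
-- and `d` are the entries at an earlier differing place, which the one difference of a `Shift`
-- compensates.
data Shift (c d : ℕ) : List ℕ → List ℕ → Set where
  here  : ∀ {x y w} → x ≢ y → x + c ≡ y + d → Shift c d (x ∷ w) (y ∷ w)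
  there : ∀ {x v w} → Shift c d v w → Shift c d (x ∷ v) (x ∷ w)

data Transfer : List ℕ → List ℕ → Set where
  here  : ∀ {x y v w} → x ≢ y → Shift x y v w → Transfer (x ∷ v) (y ∷ w)
  there : ∀ {x v w} → Transfer v w → Transfer (x ∷ v) (x ∷ w)

Shift⇒hamming≡1 : ∀ {c d v w} → Shift c d v w → hamming v w ≡ 1
Shift⇒hamming≡1 (here {w = w} x≢y _)             = trans (hamming-∷-≢ w w x≢y) (cong suc (hamming-refl w))
Shift⇒hamming≡1 (there {x = x} {v = v} {w = w} p) = trans (hamming-∷ x v w) (Shift⇒hamming≡1 p)

Transfer⇒hamming≡2 : ∀ {v w} → Transfer v w → hamming v w ≡ 2
Transfer⇒hamming≡2 (here {v = v} {w = w} x≢y p)      = trans (hamming-∷-≢ v w x≢y) (cong suc (Shift⇒hamming≡1 p))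
Transfer⇒hamming≡2 (there {x = x} {v = v} {w = w} p) = trans (hamming-∷ x v w) (Transfer⇒hamming≡2 p)

interchange : ∀ x y z → x + (y + z) ≡ y + (x + z)
interchange x y z = trans (sym (+-assoc x y z)) (trans (cong (_+ z) (+-comm x y)) (+-assoc y x z))

hamming≡1⇒Shift : ∀ {c d} v w → length v ≡ length w → sum v + c ≡ sum w + d → hamming v w ≡ 1 → Shift c d v w
hamming≡1⇒Shift []      []      _ _ h with () ← trans (sym (hamming-refl [])) h
hamming≡1⇒Shift {c} {d} (x ∷ v) (y ∷ w) l s h with x ≟ y
... | yes refl = there (hamming≡1⇒Shift v w (suc-injective l)
  (+-cancelˡ-≡ x _ _ (trans (sym (+-assoc x (sum v) c)) (trans s (+-assoc x (sum w) d))))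
  (trans (sym (hamming-∷ x v w)) h))
... | no x≢y with refl ← hamming≡0⇒≡ v w (suc-injective l) (suc-injective (trans (sym (hamming-∷-≢ v w x≢y)) h)) =
  here x≢y (+-cancelˡ-≡ (sum v) _ _ (trans (interchange (sum v) x c) (trans (sym (+-assoc x (sum v) c))
    (trans s (trans (+-assoc y (sum v) d) (interchange y (sum v) d))))))

-- As the sums agree, the two differences must compensate each other.
hamming≡2⇒Transfer : ∀ v w → length v ≡ length w → sum v ≡ sum w → hamming v w ≡ 2 → Transfer v w
hamming≡2⇒Transfer []      []      _ _ h with () ← trans (sym (hamming-refl [])) h
hamming≡2⇒Transfer (x ∷ v) (y ∷ w) l s h with x ≟ y
... | yes refl = there (hamming≡2⇒Transfer v w (suc-injective l) (+-cancelˡ-≡ x _ _ s) (trans (sym (hamming-∷ x v w)) h))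
... | no x≢y   = here x≢y (hamming≡1⇒Shift v w (suc-injective l)
  (trans (+-comm (sum v) x) (trans s (+-comm y (sum w)))) (suc-injective (trans (sym (hamming-∷-≢ v w x≢y)) h)))

Shift⇒↭ : ∀ {c d v w} → Shift c d v w →
          ∃[ x ] ∃[ y ] ∃[ m ] x + c ≡ y + d × v ↭ x ∷ m × w ↭ y ∷ m
Shift⇒↭ (here _ eq) = _ , _ , _ , eq , ↭-refl , ↭-refl
Shift⇒↭ (there {x = z} p) with x , y , m , eq , π , ρ ← Shift⇒↭ p =
  x , y , z ∷ m , eq , ↭-trans (prep z π) (swap z x ↭-refl) , ↭-trans (prep z ρ) (swap z y ↭-refl)

Transfer⇒↭ : ∀ {v w} → Transfer v w → ∃[ x ] ∃[ x′ ] ∃[ y ] ∃[ y′ ] ∃[ m ]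
             x ≢ y × x + x′ ≡ y + y′ × v ↭ x ∷ x′ ∷ m × w ↭ y ∷ y′ ∷ m
Transfer⇒↭ (here {x} {y} x≢y p) with x′ , y′ , m , eq , π , ρ ← Shift⇒↭ p =
  x , x′ , y , y′ , m , x≢y , trans (+-comm x x′) (trans eq (+-comm y′ y)) , prep x π , prep y ρ
Transfer⇒↭ (there {x = z} p) with x , x′ , y , y′ , m , x≢y , eq , π , ρ ← Transfer⇒↭ p =
  x , x′ , y , y′ , z ∷ m , x≢y , eq , ↭-trans (prep z π) (sink x x′) , ↭-trans (prep z ρ) (sink y y′)
  where
  sink : ∀ x x′ {m} → z ∷ x ∷ x′ ∷ m ↭ x ∷ x′ ∷ z ∷ m
  sink x x′ = ↭-trans (swap z x ↭-refl) (prep x (swap z x′ ↭-refl))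

-- Permuting letters preserves `rooksᵈ`, so the two changed letters can be brought to the front,
-- where `rooksᵈ-transfer` shows that they were interchanged.
rook-equivalent-transfer⇒↭ : ∀ {v w} → Transfer v w → rooksᵈ 0 0 2 v ≡ rooksᵈ 0 0 2 w → v ↭ w
rook-equivalent-transfer⇒↭ p eq with x , x′ , y , y′ , m , x≢y , s , π , ρ ← Transfer⇒↭ p
  with refl , refl ← rooksᵈ-transfer {w = m} s x≢y
         (trans (sym (rooksᵈ-↭ π 0 0 2)) (trans eq (rooksᵈ-↭ ρ 0 0 2))) =
  ↭-trans π (↭-trans (swap x x′ ↭-refl) (↭-sym ρ))

Transfer-pad⁺ : ∀ p {v w} → Transfer v w → Transfer (pad p v) (pad p w)
Transfer-pad⁺ zero    t = t
Transfer-pad⁺ (suc p) t = there (Transfer-pad⁺ p t)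

Transfer-pad⁻ : ∀ p {v w} → Transfer (pad p v) (pad p w) → Transfer v w
Transfer-pad⁻ zero    t            = t
Transfer-pad⁻ (suc p) (here 0≢0 _) = contradiction refl 0≢0
Transfer-pad⁻ (suc p) (there t)    = Transfer-pad⁻ p t

-- Exchanges of vectors and transfers of lists

lookup-injective : ∀ {n} (u v : Vec ℕ n) → (∀ l → lookup u l ≡ lookup v l) → u ≡ v
lookup-injective u v eq = trans (sym (tabulate∘lookup u)) (trans (tabulate-cong eq) (tabulate∘lookup v))

agree⇒Shift : ∀ {c d n} (u v : Vec ℕ n) j → lookup u j ≢ lookup v j → lookup u j + c ≡ lookup v j + d →
              (∀ l → l ≢ j → lookup u l ≡ lookup v l) → Shift c d (toList u) (toList v)
agree⇒Shift (x Vec.∷ u) (y Vec.∷ v) zero x≢y eq rest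
  with refl ← lookup-injective u v (λ l → rest (suc l) λ ()) = here x≢y eq
agree⇒Shift (x Vec.∷ u) (y Vec.∷ v) (suc j) x≢y eq rest
  with refl ← rest zero (λ ()) = there (agree⇒Shift u v j x≢y eq (λ l l≢j → rest (suc l) λ { refl → l≢j refl }))

agree⇒Transfer : ∀ {n} (u v : Vec ℕ n) i j → i ≢ j → lookup u i ≢ lookup v i → lookup u j ≢ lookup v j →
                 lookup u j + lookup u i ≡ lookup v j + lookup v i →
                 (∀ l → l ≢ i → l ≢ j → lookup u l ≡ lookup v l) → Transfer (toList u) (toList v)
agree⇒Transfer (_ Vec.∷ u) (_ Vec.∷ v) zero zero i≢j _ _ _ _ = contradiction refl i≢j
agree⇒Transfer (_ Vec.∷ u) (_ Vec.∷ v) zero (suc j) _ xi xj eq rest =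
  here xi (agree⇒Shift u v j xj eq (λ l l≢j → rest (suc l) (λ ()) λ { refl → l≢j refl }))
agree⇒Transfer (x Vec.∷ u) (y Vec.∷ v) (suc i) zero _ xi xj eq rest =
  here xj (agree⇒Shift u v i xi (trans (+-comm (lookup u i) x) (trans eq (+-comm y (lookup v i))))
    (λ l l≢i → rest (suc l) (λ { refl → l≢i refl }) λ ()))
agree⇒Transfer (_ Vec.∷ u) (_ Vec.∷ v) (suc i) (suc j) i≢j xi xj eq rest
  with refl ← rest zero (λ ()) (λ ()) =
  there (agree⇒Transfer u v i j (λ { refl → i≢j refl }) xi xj eq
    (λ l l≢i l≢j → rest (suc l) (λ { refl → l≢i refl }) λ { refl → l≢j refl }))

Exchange⇒Transfer : ∀ {n} {u v : Vec ℕ n} → Exchange u v → Transfer (toList u) (toList v)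
Exchange⇒Transfer {u = u} {v} (i , j , k@(suc _) , i≢j , _ , ui , uj , rest) = agree⇒Transfer u v i j i≢j
  (λ eq → m≢1+m+n _ (trans (sym eq) (trans ui (+-suc _ _)))) (λ eq → m≢1+m+n _ (trans eq (trans (sym uj) (+-suc _ _))))
  (begin
    lookup u j + lookup u i         ≡⟨ cong (_+_ (lookup u j)) (trans ui (+-comm _ k)) ⟩
    lookup u j + (k + lookup v i)   ≡⟨ +-assoc (lookup u j) k _ ⟨
    lookup u j + k + lookup v i     ≡⟨ cong (_+ lookup v i) uj ⟩
    lookup v j + lookup v i         ∎)
  rest
  where open ≡-Reasoning

Shift⇒agree : ∀ {c d v w} → Shift c d v w → ∃[ n ] Σ[ s ∈ Vec ℕ n ] Σ[ t ∈ Vec ℕ n ] Σ[ j ∈ Fin n ]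
              toList s ≡ v × toList t ≡ w × lookup s j + c ≡ lookup t j + d ×
              (∀ l → l ≢ j → lookup s l ≡ lookup t l)
Shift⇒agree (here {x} {y} {w} _ eq) =
  suc (length w) , x Vec.∷ Vec.fromList w , y Vec.∷ Vec.fromList w , zero ,
  cong (x ∷_) (toList∘fromList w) , cong (y ∷_) (toList∘fromList w) , eq ,
  λ { zero l≢0 → contradiction refl l≢0 ; (suc l) _ → refl }
Shift⇒agree (there {x} p) with n , s , t , j , refl , refl , eq , rest ← Shift⇒agree p =
  suc n , x Vec.∷ s , x Vec.∷ t , suc j , refl , refl , eq ,
  λ { zero _ → refl ; (suc l) l≢j → rest l (l≢j ∘ cong suc) }

<⇒gap : ∀ {x y x′ y′} → y < x → x′ + x ≡ y′ + y → ∃[ k ] 0 < k × x ≡ y + k × x′ + k ≡ y′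
<⇒gap {x} {y} {x′} {y′} y<x eq = x ∸ y , m<n⇒0<n∸m y<x , sym (m+[n∸m]≡n (<⇒≤ y<x)) ,
  +-cancelʳ-≡ y _ _ (trans (+-assoc x′ (x ∸ y) y) (trans (cong (_+_ x′) (m∸n+n≡m (<⇒≤ y<x))) eq))

Exchange-∷ : ∀ {n x} {u v : Vec ℕ n} → Exchange u v → Exchange (x Vec.∷ u) (x Vec.∷ v)
Exchange-∷ (i , j , k , i≢j , 0<k , ui , uj , rest) =
  suc i , suc j , k , (λ { refl → i≢j refl }) , 0<k , ui , uj ,
  λ { zero _ _ → refl ; (suc l) l≢i l≢j → rest l (l≢i ∘ cong suc) (l≢j ∘ cong suc) }

Transfer⇒Exchange : ∀ {v w} → Transfer v w → ∃[ n ] Σ[ s ∈ Vec ℕ n ] Σ[ t ∈ Vec ℕ n ]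
                    toList s ≡ v × toList t ≡ w × Exchange s t
Transfer⇒Exchange (there {x} p) with n , s , t , refl , refl , e ← Transfer⇒Exchange p =
  suc n , x Vec.∷ s , x Vec.∷ t , refl , refl , Exchange-∷ {u = s} {t} e
Transfer⇒Exchange (here {x} {y} x≢y p) with n , s , t , j , refl , refl , eq , rest ← Shift⇒agree p
  -- `Exchange` names first the column that is higher on the left; the comparison decides which of
  -- the two places that is.
  with <-cmp y x
... | tri≈ _ y≡x _ = contradiction (sym y≡x) x≢y
... | tri< y<x _ _ with k , 0<k , xk , jk ← <⇒gap y<x eq =
  suc n , x Vec.∷ s , y Vec.∷ t , refl , refl , zero , suc j , k , (λ ()) , 0<k , xk , jk ,
  λ { zero l≢0 _ → contradiction refl l≢0 ; (suc l) _ l≢j → rest l (l≢j ∘ cong suc) }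
... | tri> _ _ x<y with k , 0<k , yk , jk ← <⇒gap x<y (sym eq) =
  suc n , x Vec.∷ s , y Vec.∷ t , refl , refl , suc j , zero , k , (λ ()) , 0<k , sym jk , sym yk ,
  λ { zero _ l≢0 → contradiction refl l≢0 ; (suc l) l≢j _ → rest l (l≢j ∘ cong suc) }

-- Boards as words

-- A column of height b with i columns to its left becomes the letter i − b, so
-- truncation is harmless for the boards satisfying Below.
defects : ℕ → List ℕ → List ℕ
defects i []       = []
defects i (b ∷ bs) = i ∸ b ∷ defects (suc i) bs

data Below : ℕ → List ℕ → Set where
  []  : ∀ {i} → Below i []
  _∷_ : ∀ {i b bs} → b ≤ i → Below (suc i) bs → Below i (b ∷ bs)

-- Since `i − (i − b) = b`, the same function decodes words into column heights.
defects-involutive : ∀ {i bs} → Below i bs → defects i (defects i bs) ≡ bs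
defects-involutive []        = refl
defects-involutive (b≤i ∷ p) = cong₂ _∷_ (m∸[m∸n]≡n b≤i) (defects-involutive p)

Below-defects : ∀ i bs → Below i (defects i bs)
Below-defects i []       = []
Below-defects i (b ∷ bs) = m∸n≤m i b ∷ Below-defects (suc i) bs

length-defects : ∀ i bs → length (defects i bs) ≡ length bs
length-defects i []       = refl
length-defects i (b ∷ bs) = cong suc (length-defects (suc i) bs)

∸-+-∸ : ∀ {i j b c b′ c′} → b ≤ i → b′ ≤ i → c ≤ j → c′ ≤ j → b + c ≡ b′ + c′ →
        i ∸ b + (j ∸ c) ≡ i ∸ b′ + (j ∸ c′)
∸-+-∸ {i} {j} {b} {c} {b′} {c′} p p′ q q′ eq = +-cancelʳ-≡ (b + c) _ _ (trans (total p q)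
  (sym (trans (cong (_+_ (i ∸ b′ + (j ∸ c′))) eq) (total p′ q′))))
  where
  total : ∀ {b c} → b ≤ i → c ≤ j → i ∸ b + (j ∸ c) + (b + c) ≡ i + j
  total {b} {c} p q = begin
    i ∸ b + (j ∸ c) + (b + c)     ≡⟨ +-assoc (i ∸ b) (j ∸ c) (b + c) ⟩
    i ∸ b + (j ∸ c + (b + c))     ≡⟨ cong (_+_ (i ∸ b)) (interchange (j ∸ c) b c) ⟩
    i ∸ b + (b + (j ∸ c + c))     ≡⟨ +-assoc (i ∸ b) b _ ⟨
    i ∸ b + b + (j ∸ c + c)       ≡⟨ cong₂ _+_ (m∸n+n≡m p) (m∸n+n≡m q) ⟩
    i + j                         ∎
    where open ≡-Reasoning

∸-≢ : ∀ {i b c} → b ≤ i → c ≤ i → b ≢ c → i ∸ b ≢ i ∸ c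
∸-≢ b≤i c≤i b≢c eq = b≢c (∸-cancelˡ-≡ b≤i c≤i eq)

defects-Shift : ∀ {i j c d v w} → c ≤ i → d ≤ i → Below j v → Below j w → Shift c d v w →
                Shift (i ∸ c) (i ∸ d) (defects j v) (defects j w)
defects-Shift c≤i d≤i (p ∷ _)  (q ∷ _)  (here x≢y eq) = here (∸-≢ p q x≢y) (∸-+-∸ p q c≤i d≤i eq)
defects-Shift c≤i d≤i (_ ∷ bv) (_ ∷ bw) (there s)     = there (defects-Shift c≤i d≤i bv bw s)

defects-Transfer : ∀ {i v w} → Below i v → Below i w → Transfer v w → Transfer (defects i v) (defects i w)
defects-Transfer (p ∷ bv) (q ∷ bw) (here x≢y s) = here (∸-≢ p q x≢y) (defects-Shift p q bv bw s)
defects-Transfer (_ ∷ bv) (_ ∷ bw) (there t)    = there (defects-Transfer bv bw t)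

rooks≡rooksᵈ : ∀ {i bs} → Below i bs → ∀ j k → rooks j k bs ≡ rooksᵈ i j k (defects i bs)
rooks≡rooksᵈ _         j zero    = refl
rooks≡rooksᵈ []        j (suc k) = refl
rooks≡rooksᵈ {i} {b ∷ _} (b≤i ∷ p) j (suc k) =
  cong₂ ℤ._+_ (rooks≡rooksᵈ p j (suc k)) (cong₂ (λ h r → (h ℤ.- + j) ℤ.* r) height (rooks≡rooksᵈ p (suc j) k))
  where
  ring : ∀ b x → b ≡ b ℤ.+ x ℤ.- x
  ring = solve-∀
  height : + b ≡ + i ℤ.- + (i ∸ b)
  height = trans (ring (+ b) (+ (i ∸ b))) (cong (λ n → + n ℤ.- + (i ∸ b)) (m+[n∸m]≡n b≤i))

-- One more column lies to the left at each step, so heights that do not drop give letters that rise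
-- by at most 1. Here `m` is the previous height, so `i ∸ m` bounds the next letter.
sorted⇒Depths : ∀ {i m bs} → Linked _≤_ (m ∷ bs) → Below i bs → Depths 0 (i ∸ m) (defects i bs)
sorted⇒Depths _ [] = []
sorted⇒Depths {i} (m≤b ∷ l) (_∷_ {b = b} b≤i p) =
  node z≤n (∸-monoʳ-≤ i m≤b) (Depths-weaken (≤-reflexive (+-∸-assoc 1 b≤i)) (sorted⇒Depths l p))

Depths⇒sorted : ∀ {i u w} → u ≤ i → Depths 0 u w → Linked _≤_ (i ∸ u ∷ defects i w)
Depths⇒sorted _ [] = [-]
Depths⇒sorted {i} u≤i (node _ x≤u d) = ∸-monoʳ-≤ i x≤u ∷ Depths⇒sorted (s≤s (≤-trans x≤u u≤i)) d

Depths⇒Below : ∀ {i u w} → u ≤ i → Depths 0 u w → Below i w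
Depths⇒Below _   []             = []
Depths⇒Below u≤i (node _ x≤u d) = ≤-trans x≤u u≤i ∷ Depths⇒Below (s≤s (≤-trans x≤u u≤i)) d

All-≤-sum : ∀ bs → All (_≤ sum bs) bs
All-≤-sum []       = []
All-≤-sum (b ∷ bs) = m≤m+n b (sum bs) ∷ All.map (λ p → ≤-trans p (m≤n+m (sum bs) b)) (All-≤-sum bs)

All⇒Below : ∀ {i bs} → All (_≤ i) bs → Below i bs
All⇒Below []      = []
All⇒Below (p ∷ a) = p ∷ All⇒Below (All.map m≤n⇒m≤1+n a)

Below-pad : ∀ i p {bs} → All (_≤ i + p) bs → Below i (pad p bs)
Below-pad i zero    a = All⇒Below (All.map (λ q → ≤-trans q (≤-reflexive (+-identityʳ i))) a)
Below-pad i (suc p) a = z≤n ∷ Below-pad (suc i) p (All.map (λ q → ≤-trans q (≤-reflexive (+-suc i p))) a)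

sorted-pad : ∀ p {bs} → Linked _≤_ bs → Linked _≤_ (0 ∷ pad p bs)
sorted-pad zero    l = 0∷-sorted l
sorted-pad (suc p) l = z≤n ∷ sorted-pad p l

-- Padding to a common width

padTo : ℕ → List ℕ → List ℕ
padTo N bs = pad (N ∸ length bs) bs

length-pad : ∀ p bs → length (pad p bs) ≡ p + length bs
length-pad p bs = trans (length-++ (replicate p 0)) (cong (_+ length bs) (length-replicate p))

-- Both sides are `bs` padded to `N + n` columns; this avoids comparing the width `n` of an edge
-- with `N`.
pad-padTo : ∀ bs {N p n} → length bs ≤ N → p + length bs ≡ n → pad N (pad p bs) ≡ pad n (padTo N bs)
pad-padTo bs {N} {p} {n} l≤N eq = begin
  pad N (pad p bs)      ≡⟨ pad-+ N p bs ⟨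
  pad (N + p) bs        ≡⟨ cong (λ m → pad m bs) width ⟩
  pad (n + (N ∸ l)) bs  ≡⟨ pad-+ n (N ∸ l) bs ⟩
  pad n (padTo N bs)    ∎
  where
  open ≡-Reasoning
  l = length bs
  width : N + p ≡ n + (N ∸ l)
  width = begin
    N + p              ≡⟨ +-comm N p ⟩
    p + N              ≡⟨ cong (_+_ p) (m+[n∸m]≡n l≤N) ⟨
    p + (l + (N ∸ l))  ≡⟨ +-assoc p l _ ⟨
    p + l + (N ∸ l)    ≡⟨ cong (_+ (N ∸ l)) eq ⟩
    n + (N ∸ l)        ∎

≈⇒padTo≡ : ∀ {N} A B → length (columns A) ≤ N → length (columns B) ≤ N → A ≈ B →
           padTo N (columns A) ≡ padTo N (columns B)
≈⇒padTo≡ {N} A B l l′ (p , q , eq) = ++-cancelˡ (replicate (p + length (columns A)) 0) _ _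
  (trans (sym (pad-padTo (columns A) l refl)) (trans (cong (pad N) eq) (pad-padTo (columns B) l′
    (trans (sym (length-pad q _)) (trans (cong length (sym eq)) (length-pad p _))))))

Adjacent⇒Transfer : ∀ {N} A B → length (columns A) ≤ N → length (columns B) ≤ N → Adjacent A B →
                    Transfer (padTo N (columns A)) (padTo N (columns B))
Adjacent⇒Transfer {N} A B l l′ (n , u , v , (p , up) , (q , vq) , e) = Transfer-pad⁻ n
  (subst₂ Transfer (pad-padTo (columns A) l (width u p (columns A) up)) (pad-padTo (columns B) l′ (width v q (columns B) vq))
    (Transfer-pad⁺ N (subst₂ Transfer up vq (Exchange⇒Transfer {u = u} {v} e))))
  where
  width : ∀ (w : Vec ℕ n) p bs → toList w ≡ pad p bs → p + length bs ≡ n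
  width w p bs eq = trans (sym (length-pad p bs)) (trans (cong length (sym eq)) (length-toList w))

Transfer⇒Adjacent : ∀ {N} A B → Transfer (padTo N (columns A)) (padTo N (columns B)) → Adjacent A B
Transfer⇒Adjacent A B t with n , u , v , up , vq , e ← Transfer⇒Exchange t = n , u , v , (_ , up) , (_ , vq) , e

-- The square of words given by an isomorphism

index : Bool → Fin 2
index true  = zero
index false = suc zero

side : Bool → Bool → Fin 2 ⊎ Fin 2
side true  t = inj₁ (index t)
side false t = inj₂ (index t)

side-surjective : ∀ x → ∃[ s ] ∃[ t ] x ≡ side s t
side-surjective (inj₁ zero)       = true , true , refl
side-surjective (inj₁ (suc zero)) = true , false , refl
side-surjective (inj₂ zero)       = false , true , refl
side-surjective (inj₂ (suc zero)) = false , false , refl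

side-not : ∀ s t → side s t ≢ side s (not t)
side-not true  true  ()
side-not true  false ()
side-not false true  ()
side-not false false ()

¬same-side : ∀ s t t′ → ¬ OnOppositeSides (side s t) (side s t′)
¬same-side true  _ _ ()
¬same-side false _ _ ()

opposite-sides : ∀ s t t′ → OnOppositeSides (side s t) (side (not s) t′)
opposite-sides true  _ _ = tt
opposite-sides false _ _ = tt

module _ (B : Board) (iso : K 2 2 ≅ rookEquivalenceGraph B) where
  open _≅_ iso

  corner : Bool → Bool → Board
  corner s t = proj₁ (to (side s t))

  -- At this width the padding alone has `sum` columns, at least as many as any height, as `Below`
  -- demands.
  size : Bool → Bool → ℕ
  size s t = length (columns (corner s t)) + sum (columns (corner s t))

  N : ℕ
  N = size true true + size true false + (size false true + size false false)

  size≤N : ∀ s t → size s t ≤ N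
  size≤N true  true  = ≤-trans (m≤m+n _ _) (m≤m+n _ _)
  size≤N true  false = ≤-trans (m≤n+m _ (size true true)) (m≤m+n _ _)
  size≤N false true  = ≤-trans (m≤m+n _ _) (m≤n+m _ (size true true + size true false))
  size≤N false false = ≤-trans (m≤n+m _ (size false true)) (m≤n+m _ (size true true + size true false))

  length≤N : ∀ s t → length (columns (corner s t)) ≤ N
  length≤N s t = ≤-trans (m≤m+n _ _) (size≤N s t)

  heights : Bool → Bool → List ℕ
  heights s t = padTo N (columns (corner s t))

  length-heights : ∀ s t → length (heights s t) ≡ N
  length-heights s t = trans (length-pad (N ∸ length (columns (corner s t))) _) (m∸n+n≡m (length≤N s t))

  below : ∀ s t → Below 0 (heights s t)
  below s t = Below-pad 0 (N ∸ length bs) (All.map (λ p → ≤-trans p sum≤) (All-≤-sum bs))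
    where
    bs = columns (corner s t)
    sum≤ : sum bs ≤ N ∸ length bs
    sum≤ = ≤-trans (≤-reflexive (sym (m+n∸m≡n (length bs) (sum bs)))) (∸-monoˡ-≤ (length bs) (size≤N s t))

  word : Bool → Bool → List ℕ
  word s t = defects 0 (heights s t)

  below-word : ∀ s t → Below 0 (word s t)
  below-word s t = Below-defects 0 (heights s t)

  depths-word : ∀ s t → Depths 0 0 (word s t)
  depths-word s t = sorted⇒Depths (sorted-pad (N ∸ length (columns (corner s t))) (sorted (corner s t))) (below s t)

  rooks-word : ∀ s t k → rooksᵈ 0 0 k (word s t) ≡ + rookNumber k B
  rooks-word s t k = begin
    rooksᵈ 0 0 k (word s t)          ≡⟨ rooks≡rooksᵈ (below s t) 0 k ⟨
    rooks 0 k (heights s t)          ≡⟨ rooks-pad (N ∸ length (columns (corner s t))) k _ ⟩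
    rooks 0 k (columns (corner s t)) ≡⟨ rookNumber≡rooks k (corner s t) ⟨
    + rookNumber k (corner s t)      ≡⟨ cong +_ (proj₂ (to (side s t)) k) ⟨
    + rookNumber k B                 ∎
    where open ≡-Reasoning

  transfer : ∀ s t t′ → Transfer (word s t) (word (not s) t′)
  transfer s t t′ = defects-Transfer (below s t) (below (not s) t′)
    (Adjacent⇒Transfer (corner s t) (corner (not s) t′) (length≤N s t) (length≤N (not s) t′)
      (Equivalence.to (adj⇔adj (side s t) (side (not s) t′)) (opposite-sides s t t′)))

  cross-↭ : ∀ s t t′ → word s t ↭ word (not s) t′
  cross-↭ s t t′ = rook-equivalent-transfer⇒↭ (transfer s t t′) (trans (rooks-word s t 2) (sym (rooks-word (not s) t′ 2)))

  -- Vertices on the same side are compared through a common neighbour.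
  word-↭ : ∀ s t → word s t ↭ word true true
  word-↭ true  t = ↭-trans (cross-↭ true t true) (↭-sym (cross-↭ true true true))
  word-↭ false t = cross-↭ false t true

  -- Such a word decodes to a Ferrers board with the rook numbers of `B`, a vertex that the
  -- isomorphism must hit.
  complete : ∀ {w} → Depths 0 0 w → w ↭ word true true → ∃[ s ] ∃[ t ] w ≡ word s t
  complete {w} d π = preimage (proj₁ onto) (proj₂ onto refl)
    where
    open ≡-Reasoning
    A : Board
    A = board (defects 0 w) (Linked.tail (Depths⇒sorted z≤n d))
    |A|≡N : length (columns A) ≡ N
    |A|≡N = trans (length-defects 0 w) (trans (↭-length π)
      (trans (length-defects 0 (heights true true)) (length-heights true true)))
    rook-equivalent : RookEquivalent B A
    rook-equivalent k = ℤ.+-injective (begin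
      + rookNumber k B                        ≡⟨ rooks-word true true k ⟨
      rooksᵈ 0 0 k (word true true)           ≡⟨ rooksᵈ-↭ π 0 0 k ⟨
      rooksᵈ 0 0 k w                          ≡⟨ cong (rooksᵈ 0 0 k) (defects-involutive (Depths⇒Below z≤n d)) ⟨
      rooksᵈ 0 0 k (defects 0 (defects 0 w))  ≡⟨ rooks≡rooksᵈ (Below-defects 0 w) 0 k ⟨
      rooks 0 k (columns A)                   ≡⟨ rookNumber≡rooks k A ⟨
      + rookNumber k A                        ∎)
    onto = Bijection.surjective bijection (A , rook-equivalent)
    preimage : ∀ x → proj₁ (to x) ≈ A → ∃[ s ] ∃[ t ] w ≡ word s t
    preimage x x≈A with s , t , refl ← side-surjective x = s , t , (begin
      w                                ≡⟨ defects-involutive (Depths⇒Below z≤n d) ⟨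
      -- `A` already has `N` columns, so `padTo N` adds none.
      defects 0 (defects 0 w)          ≡⟨ cong (λ p → defects 0 (pad p (defects 0 w))) (trans (cong (N ∸_) |A|≡N) (n∸n≡0 N)) ⟨
      defects 0 (padTo N (columns A))  ≡⟨ cong (defects 0) (≈⇒padTo≡ (corner s t) A (length≤N s t) (≤-reflexive |A|≡N) x≈A) ⟨
      word s t                         ∎)

  -- Permuted words have equal sums, so distance 2 gives a transfer, which decodes to an edge inside
  -- a side of `K 2 2`.
  same : ∀ s t t′ → hamming (word s t) (word s t′) ≢ 2
  same s t t′ h = ¬same-side s t t′ (Equivalence.from (adj⇔adj (side s t) (side s t′))
    (Transfer⇒Adjacent {N} (corner s t) (corner s t′)
      (subst₂ Transfer (defects-involutive (below s t)) (defects-involutive (below s t′))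
        (defects-Transfer (below-word s t) (below-word s t′)
          (hamming≡2⇒Transfer _ _ (↭-length π) (sum-↭ π) h)))))
    where
    π : word s t ↭ word s t′
    π = ↭-trans (word-↭ s t) (↭-sym (word-↭ s t′))

  distinct : ∀ s t → word s t ≢ word s (not t)
  distinct s t eq = side-not s t (Bijection.injective bijection (_ , _ ,
    trans (sym (defects-involutive (below s t))) (trans (cong (defects 0) eq) (defects-involutive (below s (not t))))))

  square : Square 0 (word true true)
  square = record
    { vert     = word
    ; depths   = depths-word
    ; perm     = word-↭
    ; complete = complete
    ; cross    = λ s t t′ → Transfer⇒hamming≡2 (transfer s t t′)
    ; same     = same
    ; distinct = distinct
    }

theorem12 : (B : Board) → ¬ (K 2 2 ≅ rookEquivalenceGraph B)
theorem12 B iso = ¬square (length (word B iso true true)) refl (square B iso)
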